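{- For all real $t \geq 1$ let $\mathcal{D}(t) := \sum_{n \leq t}\sigma(n) - \frac{t^2 \zeta(2)}{2}$. Then, for all real $x \geq 650$, $$\int_1^{x} \frac{\mathcal{D}(t)}{t^{2}} \, \mathrm{d}t < 0.$$
   Context: $\sigma(n) = \sum_{d \mid n} d$ is the sum-of-divisors function, $\zeta$ is the Riemann zeta function; sums $\sum_{n\le t}$ run over positive integers $n \le t$. -}

module Defs where

open import Level using (Level; suc)
open import Algebra.Bundles using (CommutativeRing)
open import Data.Nat.Base as ℕ using (ℕ; zero; NonZero; NonTrivial)
import Data.Nat.Properties as ℕ
open import Data.Nat.Divisibility using (_∣?_)
open import Data.Nat.ListAction using (sum)
open import Data.List.Base using (List; filter; map; upTo)
open import Data.Product using (∃; _×_; _,_; proj₁; proj₂)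
open import Data.Sum.Base using (inj₁; inj₂)
open import Data.Unit.Polymorphic.Base using (⊤)
open import Relation.Binary.Bundles using (StrictTotalOrder)
open import Relation.Binary.Core using (Rel)
open import Relation.Binary.Definitions using (tri<; tri≈; tri>)
open import Relation.Binary.Structures using (IsStrictTotalOrder)
import Relation.Binary.Construct.StrictToNonStrict as NonStrict
import Relation.Binary.Reasoning.StrictPartialOrder as OrderReasoning
open import Relation.Nullary using (¬_; yes; no; contradiction)
import Algebra.Properties.Semiring.Exp as Exp
import Algebra.Properties.Semiring.Mult as Mult

-- ℝ, through its characterisation up to unique isomorphism: a totally ordered
-- field with suprema. The order is decidable, i.e. this is the classical ℝ.

record CompleteOrderedField (ℓ : Level) : Set (suc ℓ) where
  infix  4 _<_
  infix  9 _⁻¹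
  infixl 7 _/_
  field
    commutativeRing : CommutativeRing ℓ ℓ

  open CommutativeRing commutativeRing public

  field
    _<_                : Rel Carrier ℓ
    isStrictTotalOrder : IsStrictTotalOrder _≈_ _<_

  open IsStrictTotalOrder isStrictTotalOrder public
    using (compare; _<?_) renaming (trans to <-trans; irrefl to <-irrefl)
  open NonStrict _≈_ _<_ public using (_≤_)

  -- As z < s is not an upper bound of P, least-ness is stated by exhibiting an
  -- element of P above z.
  IsSupremum : (Carrier → Set ℓ) → Carrier → Set ℓ
  IsSupremum P s = (∀ y → P y → y ≤ s) × (∀ z → z < s → ∃ λ y → P y × z < y)

  field
    0<1       : 0# < 1#
    +-monoʳ-< : ∀ z {x y} → x < y → z + x < z + y
    *-pos     : ∀ {x y} → 0# < x → 0# < y → 0# < x * y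

    -- The inverse is total; nothing is assumed about the value of 0# ⁻¹.
    _⁻¹        : Carrier → Carrier
    ⁻¹-cong    : ∀ {x y} → x ≈ y → x ⁻¹ ≈ y ⁻¹
    ⁻¹-inverse : ∀ {x} → ¬ (x ≈ 0#) → x * x ⁻¹ ≈ 1#

    supremum : (P : Carrier → Set ℓ) → ∃ P → (∃ λ b → ∀ y → P y → y ≤ b) →
               ∃ (IsSupremum P)

  _/_ : Carrier → Carrier → Carrier
  x / y = x * y ⁻¹

1⋯_ : ℕ → List ℕ
1⋯ n = map ℕ.suc (upTo n)

σ : ℕ → ℕ
σ n = sum (filter (_∣? n) (1⋯ n))

module RealAnalysis {ℓ : Level} (ℝ : CompleteOrderedField ℓ) where

  open CompleteOrderedField ℝ public
  open Exp semiring public using (_^_)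
  open Mult semiring using () renaming (_×_ to _·_; ×1-homo-* to ·1-homo-*)

  fromℕ : ℕ → Carrier
  fromℕ n = n · 1#

  private
    strictTotalOrder : StrictTotalOrder ℓ ℓ ℓ
    strictTotalOrder = record { isStrictTotalOrder = isStrictTotalOrder }

  module ≤-Reasoning = OrderReasoning (StrictTotalOrder.strictPartialOrder strictTotalOrder)

  open ≤-Reasoning

  ≮⇒≥ : ∀ {x y} → ¬ (x < y) → y ≤ x
  ≮⇒≥ {x} {y} x≮y with compare x y
  ... | tri< x<y _ _ = contradiction x<y x≮y
  ... | tri≈ _ x≈y _ = inj₂ (sym x≈y)
  ... | tri> _ _ y<x = inj₁ y<x

  ≤⇒≯ : ∀ {x y} → x ≤ y → ¬ (y < x)
  ≤⇒≯ {x} {y} x≤y y<x = <-irrefl refl (begin-strict x ≤⟨ x≤y ⟩ y <⟨ y<x ⟩ x ∎)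

  ≤-refl : ∀ {x} → x ≤ x
  ≤-refl = inj₂ refl

  ≤-trans : ∀ {x y z} → x ≤ y → y ≤ z → x ≤ z
  ≤-trans {x} {y} {z} x≤y y≤z = begin x ≤⟨ x≤y ⟩ y ≤⟨ y≤z ⟩ z ∎

  +-monoʳ-≤ : ∀ z {x y} → x ≤ y → z + x ≤ z + y
  +-monoʳ-≤ z (inj₁ x<y) = inj₁ (+-monoʳ-< z x<y)
  +-monoʳ-≤ z (inj₂ x≈y) = inj₂ (+-congˡ x≈y)

  +-monoˡ-< : ∀ z {x y} → x < y → x + z < y + z
  +-monoˡ-< z {x} {y} x<y = begin-strict
    x + z ≈⟨ +-comm x z ⟩
    z + x <⟨ +-monoʳ-< z x<y ⟩
    z + y ≈⟨ +-comm z y ⟩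
    y + z ∎

  +-monoˡ-≤ : ∀ z {x y} → x ≤ y → x + z ≤ y + z
  +-monoˡ-≤ z (inj₁ x<y) = inj₁ (+-monoˡ-< z x<y)
  +-monoˡ-≤ z (inj₂ x≈y) = inj₂ (+-congʳ x≈y)

  x≤x+y : ∀ x {y} → 0# ≤ y → x ≤ x + y
  x≤x+y x {y} 0≤y = begin
    x      ≈⟨ +-identityʳ x ⟨
    x + 0# ≤⟨ +-monoʳ-≤ x 0≤y ⟩
    x + y  ∎

  x-y+y≈x : ∀ x y → (x - y) + y ≈ x
  x-y+y≈x x y = begin-equality
    (x - y) + y     ≈⟨ +-assoc x (- y) y ⟩
    x + (- y + y)   ≈⟨ +-congˡ (-‿inverseˡ y) ⟩
    x + 0#          ≈⟨ +-identityʳ x ⟩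
    x               ∎

  y+[x-y]≈x : ∀ x y → y + (x - y) ≈ x
  y+[x-y]≈x x y = trans (+-comm y (x - y)) (x-y+y≈x x y)

  x+y-y≈x : ∀ x y → (x + y) - y ≈ x
  x+y-y≈x x y = begin-equality
    (x + y) - y     ≈⟨ +-assoc x y (- y) ⟩
    x + (y - y)     ≈⟨ +-congˡ (-‿inverseʳ y) ⟩
    x + 0#          ≈⟨ +-identityʳ x ⟩
    x               ∎

  x-y<x : ∀ x {y} → 0# < y → x - y < x
  x-y<x x {y} 0<y = begin-strict
    x - y           ≈⟨ +-identityʳ (x - y) ⟨
    (x - y) + 0#    <⟨ +-monoʳ-< (x - y) 0<y ⟩
    (x - y) + y     ≈⟨ x-y+y≈x x y ⟩
    x               ∎

  x<y+z⇒x-y<z : ∀ {x y z} → x < y + z → x - y < z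
  x<y+z⇒x-y<z {x} {y} {z} x<y+z = begin-strict
    x - y           <⟨ +-monoˡ-< (- y) x<y+z ⟩
    (y + z) - y     ≈⟨ +-congʳ (+-comm y z) ⟩
    (z + y) - y     ≈⟨ x+y-y≈x z y ⟩
    z               ∎

  *-monoʳ-≤ : ∀ {z} → 0# < z → ∀ {x y} → x ≤ y → z * x ≤ z * y
  *-monoʳ-≤ {z} 0<z {x} {y} (inj₂ x≈y) = inj₂ (*-congˡ x≈y)
  *-monoʳ-≤ {z} 0<z {x} {y} (inj₁ x<y) = begin
    z * x                 ≤⟨ x≤x+y (z * x) (inj₁ (*-pos 0<z 0<y-x)) ⟩
    z * x + z * (y - x)   ≈⟨ distribˡ z x (y - x) ⟨
    z * (x + (y - x))     ≈⟨ *-congˡ (y+[x-y]≈x y x) ⟩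
    z * y                 ∎
    where
    0<y-x : 0# < y - x
    0<y-x = begin-strict
      0#      ≈⟨ -‿inverseʳ x ⟨
      x - x   <⟨ +-monoˡ-< (- x) x<y ⟩
      y - x   ∎

  0≤fromℕ : ∀ n → 0# ≤ fromℕ n
  0≤fromℕ zero      = ≤-refl
  0≤fromℕ (ℕ.suc n) = ≤-trans (inj₁ 0<1) (x≤x+y 1# (0≤fromℕ n))

  0<fromℕ : ∀ n .{{_ : NonZero n}} → 0# < fromℕ n
  0<fromℕ (ℕ.suc n) = begin-strict
    0#            <⟨ 0<1 ⟩
    1#            ≤⟨ x≤x+y 1# (0≤fromℕ n) ⟩
    1# + fromℕ n  ∎

  fromℕ-mono-≤ : ∀ {m n} → m ℕ.≤ n → fromℕ m ≤ fromℕ n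
  fromℕ-mono-≤ {_} {n} ℕ.z≤n   = 0≤fromℕ n
  fromℕ-mono-≤ (ℕ.s≤s m≤n)     = +-monoʳ-≤ 1# (fromℕ-mono-≤ m≤n)

  0<⇒≉0 : ∀ {x} → 0# < x → ¬ (x ≈ 0#)
  0<⇒≉0 0<x x≈0 = <-irrefl (sym x≈0) 0<x

  ⁻¹-pos : ∀ {x} → 0# < x → 0# < x ⁻¹
  ⁻¹-pos {x} 0<x with compare 0# (x ⁻¹)
  ... | tri< 0<x⁻¹ _ _ = 0<x⁻¹
  ... | tri≈ _ 0≈x⁻¹ _ = contradiction 0<1 (≤⇒≯ (begin
    1#          ≈⟨ ⁻¹-inverse (0<⇒≉0 0<x) ⟨
    x * x ⁻¹    ≈⟨ *-congˡ 0≈x⁻¹ ⟨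
    x * 0#      ≈⟨ zeroʳ x ⟩
    0#          ∎))
  ... | tri> _ _ x⁻¹<0 = contradiction 0<1 (≤⇒≯ (begin
    1#          ≈⟨ ⁻¹-inverse (0<⇒≉0 0<x) ⟨
    x * x ⁻¹    ≤⟨ *-monoʳ-≤ 0<x (inj₁ x⁻¹<0) ⟩
    x * 0#      ≈⟨ zeroʳ x ⟩
    0#          ∎))

  ⁻¹-antimono-≤ : ∀ {x y} → 0# < x → x ≤ y → y ⁻¹ ≤ x ⁻¹
  ⁻¹-antimono-≤ {x} {y} 0<x x≤y = begin
    y ⁻¹                ≈⟨ *-identityʳ (y ⁻¹) ⟨
    y ⁻¹ * 1#           ≈⟨ *-congˡ (⁻¹-inverse (0<⇒≉0 0<x)) ⟨
    y ⁻¹ * (x * x ⁻¹)   ≈⟨ *-assoc _ _ _ ⟨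
    y ⁻¹ * x * x ⁻¹     ≈⟨ *-comm _ _ ⟩
    x ⁻¹ * (y ⁻¹ * x)   ≤⟨ *-monoʳ-≤ (⁻¹-pos 0<x) (*-monoʳ-≤ (⁻¹-pos 0<y) x≤y) ⟩
    x ⁻¹ * (y ⁻¹ * y)   ≈⟨ *-congˡ (*-comm _ _) ⟩
    x ⁻¹ * (y * y ⁻¹)   ≈⟨ *-congˡ (⁻¹-inverse (0<⇒≉0 0<y)) ⟩
    x ⁻¹ * 1#           ≈⟨ *-identityʳ (x ⁻¹) ⟩
    x ⁻¹                ∎
    where
    0<y : 0# < y
    0<y = begin-strict 0# <⟨ 0<x ⟩ x ≤⟨ x≤y ⟩ y ∎

  floor : ∀ t → 0# ≤ t → ∃ λ n → fromℕ n ≤ t × t < fromℕ (ℕ.suc n)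
  floor t 0≤t with supremum (λ y → ∃ λ n → y ≈ fromℕ n × y ≤ t)
                            (0# , 0 , refl , 0≤t) (t , λ _ (_ , _ , y≤t) → y≤t)
  ... | s , upper , approx with approx (s - 1#) (x-y<x s 0<1)
  ...   | y , (n , y≈n , y≤t) , s-1<y with t <? fromℕ (ℕ.suc n)
  ...     | yes t<1+n = n , ≤-trans (inj₂ (sym y≈n)) y≤t , t<1+n
  ...     | no  t≮1+n = contradiction s<1+n
              (≤⇒≯ (upper (fromℕ (ℕ.suc n)) (ℕ.suc n , refl , ≮⇒≥ t≮1+n)))
    where
    s<1+n : s < fromℕ (ℕ.suc n)
    s<1+n = begin-strict
      s               ≈⟨ y+[x-y]≈x s 1# ⟨
      1# + (s - 1#)   <⟨ +-monoʳ-< 1# s-1<y ⟩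
      1# + y          ≈⟨ +-congˡ y≈n ⟩
      1# + fromℕ n    ∎

  -- Integer part for t ≥ 0, and 0 for t < 0: the number of positive integers ≤ t.
  ⌊_⌋ : Carrier → ℕ
  ⌊ t ⌋ with t <? 0#
  ... | yes _   = 0
  ... | no  t≮0 = proj₁ (floor t (≮⇒≥ t≮0))

  infix 4 _≈[_]_ _SumsTo_

  -- ∣ x - y ∣ < ε
  _≈[_]_ : Carrier → Carrier → Carrier → Set ℓ
  x ≈[ ε ] y = x - y < ε × y - x < ε

  partialSum : (ℕ → Carrier) → ℕ → Carrier
  partialSum a zero      = 0#
  partialSum a (ℕ.suc n) = partialSum a n + a n

  _SumsTo_ : (ℕ → Carrier) → Carrier → Set ℓ
  a SumsTo s = ∀ ε → 0# < ε → ∃ λ N → ∀ n → N ℕ.≤ n → partialSum a n ≈[ ε ] s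

  partialSum-mono : ∀ {a} → (∀ n → 0# ≤ a n) → ∀ {m n} → m ℕ.≤′ n →
                    partialSum a m ≤ partialSum a n
  partialSum-mono 0≤a ℕ.≤′-refl       = ≤-refl
  partialSum-mono 0≤a (ℕ.≤′-step m≤n) =
    ≤-trans (partialSum-mono 0≤a m≤n) (x≤x+y _ (0≤a _))

  bounded⇒converges : ∀ a b → (∀ n → 0# ≤ a n) → (∀ n → partialSum a n ≤ b) →
                      ∃ (a SumsTo_)
  bounded⇒converges a b 0≤a bound
    with supremum (λ y → ∃ λ n → y ≈ partialSum a n) (0# , 0 , refl)
                  (b , λ _ (n , y≈) → ≤-trans (inj₂ y≈) (bound n))
  ... | s , upper , approx = s , converges
    where
    converges : a SumsTo s
    converges ε 0<ε with approx (s - ε) (x-y<x s 0<ε)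
    ... | y , (N , y≈) , s-ε<y = N , λ n N≤n →
      x<y+z⇒x-y<z (begin-strict
        partialSum a n   ≤⟨ upper _ (n , refl) ⟩
        s                ≈⟨ +-identityʳ s ⟨
        s + 0#           <⟨ +-monoʳ-< s 0<ε ⟩
        s + ε            ∎) ,
      x<y+z⇒x-y<z (begin-strict
        s                    ≈⟨ x-y+y≈x s ε ⟨
        (s - ε) + ε          <⟨ +-monoˡ-< ε s-ε<y ⟩
        y + ε                ≈⟨ +-congʳ y≈ ⟩
        partialSum a N + ε   ≤⟨ +-monoˡ-≤ ε (partialSum-mono 0≤a (ℕ.≤⇒≤′ N≤n)) ⟩
        partialSum a n + ε   ∎)

  -- The n-th term is (n + 1)⁻ˢ, since partialSum starts at index 0.
  zetaTerm : ℕ → ℕ → Carrier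
  zetaTerm s n = 1# / fromℕ (ℕ.suc n ℕ.^ s)

  zetaTerm-pos : ∀ s n → 0# ≤ zetaTerm s n
  zetaTerm-pos s n = inj₁ (*-pos 0<1 (⁻¹-pos (0<fromℕ _ {{ℕ.m^n≢0 (ℕ.suc n) s}})))

  module _ (n : ℕ) where
    private
      p q : Carrier
      p = fromℕ (ℕ.suc n)
      q = fromℕ (ℕ.suc (ℕ.suc n))

      p⁻¹ : p * p ⁻¹ ≈ 1#
      p⁻¹ = ⁻¹-inverse (0<⇒≉0 (0<fromℕ (ℕ.suc n)))

      q⁻¹ : q * q ⁻¹ ≈ 1#
      q⁻¹ = ⁻¹-inverse (0<⇒≉0 (0<fromℕ (ℕ.suc (ℕ.suc n))))

    telescope : q ⁻¹ + p ⁻¹ * q ⁻¹ ≈ p ⁻¹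
    telescope = begin-equality
      q ⁻¹ + p ⁻¹ * q ⁻¹                ≈⟨ +-congʳ (trans (sym (*-identityˡ _)) (*-congʳ (sym p⁻¹))) ⟩
      p * p ⁻¹ * q ⁻¹ + p ⁻¹ * q ⁻¹     ≈⟨ distribʳ _ _ _ ⟨
      (p * p ⁻¹ + p ⁻¹) * q ⁻¹          ≈⟨ *-congʳ (+-congˡ (*-identityˡ _)) ⟨
      (p * p ⁻¹ + 1# * p ⁻¹) * q ⁻¹     ≈⟨ *-congʳ (distribʳ _ _ _) ⟨
      (p + 1#) * p ⁻¹ * q ⁻¹            ≈⟨ *-congʳ (*-congʳ (+-comm p 1#)) ⟩
      q * p ⁻¹ * q ⁻¹                   ≈⟨ *-congʳ (*-comm q (p ⁻¹)) ⟩
      p ⁻¹ * q * q ⁻¹                   ≈⟨ *-assoc _ _ _ ⟩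
      p ⁻¹ * (q * q ⁻¹)                 ≈⟨ *-congˡ q⁻¹ ⟩
      p ⁻¹ * 1#                         ≈⟨ *-identityʳ _ ⟩
      p ⁻¹                              ∎

    zetaTerm-bound : ∀ k → zetaTerm (ℕ.suc (ℕ.suc k)) (ℕ.suc n) ≤ p ⁻¹ * q ⁻¹
    zetaTerm-bound k = begin
      1# * r ⁻¹                          ≈⟨ *-identityˡ _ ⟩
      r ⁻¹                               ≈⟨ *-identityʳ _ ⟨
      r ⁻¹ * 1#                          ≈⟨ *-congˡ one ⟨
      r ⁻¹ * (p * q * (p ⁻¹ * q ⁻¹))     ≈⟨ *-assoc _ _ _ ⟨
      r ⁻¹ * (p * q) * (p ⁻¹ * q ⁻¹)     ≈⟨ *-comm _ _ ⟩
      p ⁻¹ * q ⁻¹ * (r ⁻¹ * (p * q))     ≤⟨ *-monoʳ-≤ (*-pos (⁻¹-pos 0<p) (⁻¹-pos 0<q))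
                                              (*-monoʳ-≤ (⁻¹-pos 0<r) pq≤r) ⟩
      p ⁻¹ * q ⁻¹ * (r ⁻¹ * r)           ≈⟨ *-congˡ (trans (*-comm _ _) (⁻¹-inverse (0<⇒≉0 0<r))) ⟩
      p ⁻¹ * q ⁻¹ * 1#                   ≈⟨ *-identityʳ _ ⟩
      p ⁻¹ * q ⁻¹                        ∎
      where
      m = ℕ.suc (ℕ.suc n)
      r = fromℕ (m ℕ.^ ℕ.suc (ℕ.suc k))

      0<p : 0# < p
      0<p = 0<fromℕ (ℕ.suc n)

      0<q : 0# < q
      0<q = 0<fromℕ m

      0<r : 0# < r
      0<r = 0<fromℕ _ {{ℕ.m^n≢0 m (ℕ.suc (ℕ.suc k))}}

      one : p * q * (p ⁻¹ * q ⁻¹) ≈ 1#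
      one = begin-equality
        p * q * (p ⁻¹ * q ⁻¹)      ≈⟨ *-assoc _ _ _ ⟩
        p * (q * (p ⁻¹ * q ⁻¹))    ≈⟨ *-congˡ (*-congˡ (*-comm _ _)) ⟩
        p * (q * (q ⁻¹ * p ⁻¹))    ≈⟨ *-congˡ (*-assoc _ _ _) ⟨
        p * (q * q ⁻¹ * p ⁻¹)      ≈⟨ *-congˡ (*-congʳ q⁻¹) ⟩
        p * (1# * p ⁻¹)            ≈⟨ *-congˡ (*-identityˡ _) ⟩
        p * p ⁻¹                   ≈⟨ p⁻¹ ⟩
        1#                         ∎

      nat : ℕ.suc n ℕ.* m ℕ.≤ m ℕ.^ ℕ.suc (ℕ.suc k)
      nat = ℕ.≤-trans (ℕ.≤-reflexive (ℕ.*-comm (ℕ.suc n) m))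
        (ℕ.*-monoʳ-≤ m (ℕ.≤-trans (ℕ.n≤1+n (ℕ.suc n))
          (ℕ.m≤m*n m (m ℕ.^ k) {{ℕ.m^n≢0 m k}})))

      pq≤r : p * q ≤ r
      pq≤r = ≤-trans (inj₂ (sym (·1-homo-* (ℕ.suc n) m))) (fromℕ-mono-≤ nat)

  -- Σ_{n ≤ N} n⁻ˢ + 1/N ≤ 1⁻ˢ + 1/1
  zeta-partialSum : ∀ k n → partialSum (zetaTerm (ℕ.suc (ℕ.suc k))) (ℕ.suc n) + fromℕ (ℕ.suc n) ⁻¹
                            ≤ partialSum (zetaTerm (ℕ.suc (ℕ.suc k))) 1 + fromℕ 1 ⁻¹
  zeta-partialSum k zero      = ≤-refl
  zeta-partialSum k (ℕ.suc n) = begin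
    S + a + q ⁻¹               ≈⟨ trans (+-assoc _ _ _) (+-congˡ (+-comm _ _)) ⟩
    S + (q ⁻¹ + a)             ≤⟨ +-monoʳ-≤ S (+-monoʳ-≤ (q ⁻¹) (zetaTerm-bound n k)) ⟩
    S + (q ⁻¹ + p ⁻¹ * q ⁻¹)   ≈⟨ +-congˡ (telescope n) ⟩
    S + p ⁻¹                   ≤⟨ zeta-partialSum k n ⟩
    _                          ∎
    where
    S = partialSum (zetaTerm (ℕ.suc (ℕ.suc k))) (ℕ.suc n)
    a = zetaTerm (ℕ.suc (ℕ.suc k)) (ℕ.suc n)
    p = fromℕ (ℕ.suc n)
    q = fromℕ (ℕ.suc (ℕ.suc n))

  zeta-converges : ∀ s .{{_ : NonTrivial s}} → ∃ (zetaTerm s SumsTo_)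
  zeta-converges s@(ℕ.suc (ℕ.suc k)) = bounded⇒converges (zetaTerm s) _ (zetaTerm-pos s) λ n → begin
    partialSum (zetaTerm s) n              ≤⟨ x≤x+y _ (zetaTerm-pos s n) ⟩
    partialSum (zetaTerm s) (ℕ.suc n)      ≤⟨ x≤x+y _ (inj₁ (⁻¹-pos (0<fromℕ (ℕ.suc n)))) ⟩
    partialSum (zetaTerm s) (ℕ.suc n) + fromℕ (ℕ.suc n) ⁻¹
                                           ≤⟨ zeta-partialSum k n ⟩
    partialSum (zetaTerm s) 1 + fromℕ 1 ⁻¹ ∎

  -- The Riemann zeta function at integers s ≥ 2.
  ζ : (s : ℕ) .{{_ : NonTrivial s}} → Carrier
  ζ s = proj₁ (zeta-converges s)

  -- Tagged partitions of [a , b]; cell m t is the interval [a , m] with tag t.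
  data TaggedPartition (a b : Carrier) : Set ℓ where
    end  : a ≈ b → TaggedPartition a b
    cell : ∀ m t → a ≤ t → t ≤ m → TaggedPartition m b → TaggedPartition a b

  riemannSum : ∀ {a b} → (Carrier → Carrier) → TaggedPartition a b → Carrier
  riemannSum         f (end _)          = 0#
  riemannSum {a = a} f (cell m t _ _ P) = f t * (m - a) + riemannSum f P

  MeshBelow : ∀ {a b} → Carrier → TaggedPartition a b → Set ℓ
  MeshBelow         δ (end _)          = ⊤
  MeshBelow {a = a} δ (cell m _ _ _ P) = m - a < δ × MeshBelow δ P

  -- Riemann integrability of f on [a , b] with integral I, for a ≤ b; there are
  -- no tagged partitions when b < a.
  IsIntegral : (a b : Carrier) → (Carrier → Carrier) → Carrier → Set ℓ
  IsIntegral a b f I =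
    ∀ ε → 0# < ε → ∃ λ δ → 0# < δ ×
      (∀ (P : TaggedPartition a b) → MeshBelow δ P → riemannSum f P ≈[ ε ] I)

  𝒟 : Carrier → Carrier
  𝒟 t = fromℕ (sum (map σ (1⋯ ⌊ t ⌋))) - t ^ 2 * ζ 2 / fromℕ 2

{-# OPTIONS --safe #-}
-- For e ≥ 1 put u = x / e. Writing n = d e for the divisors d of n and integrating
-- [n ≤ t] / t² over [1 , x], the integral of the statement equals
--   Σ_{e ≤ x} Σ_{d ≤ u} (1/e - d/x) - (x - 1) ζ(2) / 2.
-- With M = ⌊u⌋ the inner sum is (2 u M - M² - M) / (2x), and
--   2 u M - M² - M = u² - u + 1/4 - (u - M - 1/2)².
-- Hence the integral is at most
--   (1/2) (x (Σ_{e ≤ x} 1/e² - ζ(2)) - Σ_{e ≤ x} 1/e + 1/4 + ζ(2)),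
-- which is negative as soon as the harmonic sum exceeds 9/4, because ζ(2) ≤ 2.
module Submission where

open import Defs
open import Level using (Level)
open import Data.Product using (∃; _×_)
open import Algebra.Bundles using (CommutativeRing)
import Algebra.Properties.CommutativeSemigroup as CommutativeSemigroupProperties
import Algebra.Properties.Ring as RingProperties
import Algebra.Properties.Semiring.Mult as Mult
import Algebra.Properties.Semiring.Mult.TCOptimised as MultTCOptimised
import Algebra.Solver.Ring as RingSolver
open import Algebra.Solver.Ring.AlmostCommutativeRing
  using (_-Raw-AlmostCommutative⟶_; fromCommutativeRing)
open import Data.Bool.Base using (if_then_else_; true; false)
open import Data.Integer.Base as ℤ using (ℤ; +_; -[1+_])
import Data.Integer.Properties as ℤ
open import Data.List.Base using ([]; _∷_; _∷ʳ_; filter; map; upTo)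
open import Data.List.Properties using (map-∘; map-++; upTo-∷ʳ)
import Data.Maybe.Base as Maybe
open import Data.Nat.Base as ℕ using (ℕ; zero; suc; NonZero; z≤n; s≤s)
open import Data.Nat.Divisibility using (_∣?_; divides; ∣⇒≤)
open import Data.Nat.ListAction using (sum)
open import Data.Nat.ListAction.Properties using (sum-++)
import Data.Nat.Properties as ℕ
open import Data.Product using (_,_; proj₁; proj₂)
open import Data.Sum.Base using (_⊎_; inj₁; inj₂)
open import Function.Base using (_∘_)
open import Relation.Binary.Definitions using (tri<; tri≈; tri>)
open import Relation.Binary.PropositionalEquality as ≡ using (_≡_; _≢_)
import Relation.Binary.Reasoning.Setoid as SetoidReasoning
open import Relation.Nullary using (¬_; Dec; does; yes; no; contradiction)
open import Relation.Nullary.Decidable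
  using (True; toWitness; dec-true; dec-false; dec⇒maybe)
open import Relation.Unary using (Pred; Decidable)

-- The integral is a limit of Riemann sums over arbitrary tagged partitions, and the integrand jumps
-- at every positive integer up to `x`. Termwise integration therefore needs an explicit error
-- bound. On all of [1 , x] the integrand is one finite sum of multiples `d ≥ 0` of the steps
-- [e d ≤ t] / t², with both `e` and `d` running up to ⌊x⌋, plus the constant -ζ(2)/2. Each step
-- comes with an antiderivative and with a monotone function whose increments bound the Riemann
-- error on every cell, including a cell that contains the jump. Such data pass to sums and to
-- nonnegative multiples, so the value of the integral is the increment of an explicit function. In
-- the final bound, the summand 1/4 collects at most 1/(4x) from each of the ⌊x⌋ ≤ x rows, and the
-- lone ζ(2) comes from the lower endpoint 1.

-- A ring solver with integer coefficients.

module IntegerCoefficients {c ℓ} (R : CommutativeRing c ℓ) where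
  open CommutativeRing R
  open RingProperties ring
  open MultTCOptimised semiring renaming (_×_ to _·_)
  open SetoidReasoning setoid

  -- With the optimised multiples, `1 · 1#` is `1#` itself and not `1# + 0#`, so the solver
  -- constants `:0` and `:1` denote exactly `0#` and `1#`.
  ⟦_⟧ : ℤ → Carrier
  ⟦ + n ⟧      = n · 1#
  ⟦ -[1+ n ] ⟧ = - (suc n · 1#)

  neg-homo : ∀ i → ⟦ ℤ.- i ⟧ ≈ - ⟦ i ⟧
  neg-homo (+ zero)   = sym -0#≈0#
  neg-homo (+ suc n)  = refl
  neg-homo (-[1+ n ]) = sym (-‿involutive _)

  ⊖-homo : ∀ m n → ⟦ m ℤ.⊖ n ⟧ ≈ m · 1# - n · 1#
  ⊖-homo m       zero    = sym (trans (+-congˡ -0#≈0#) (+-identityʳ _))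
  ⊖-homo zero    (suc n) = sym (+-identityˡ _)
  ⊖-homo (suc m) (suc n) = begin
    ⟦ suc m ℤ.⊖ suc n ⟧                 ≡⟨ ≡.cong ⟦_⟧ (ℤ.[1+m]⊖[1+n]≡m⊖n m n) ⟩
    ⟦ m ℤ.⊖ n ⟧                         ≈⟨ ⊖-homo m n ⟩
    x - y                               ≈⟨ +-congˡ (+-identityˡ (- y)) ⟨
    x + (0# - y)                        ≈⟨ +-congˡ (+-congʳ (-‿inverseʳ 1#)) ⟨
    x + (1# - 1# - y)                   ≈⟨ +-congˡ (+-assoc _ _ _) ⟩
    x + (1# + (- 1# - y))               ≈⟨ +-assoc _ _ _ ⟨
    (x + 1#) + (- 1# - y)               ≈⟨ +-cong (+-comm x 1#) (-‿+-comm 1# y) ⟩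
    (1# + x) - (1# + y)                 ≈⟨ +-cong (1+× m 1#) (-‿cong (1+× n 1#)) ⟨
    suc m · 1# - suc n · 1#             ∎
    where x = m · 1# ; y = n · 1#

  +-homo : ∀ i j → ⟦ i ℤ.+ j ⟧ ≈ ⟦ i ⟧ + ⟦ j ⟧
  +-homo (+ m)      (+ n)      = ×-homo-+ 1# m n
  +-homo (+ m)      (-[1+ n ]) = ⊖-homo m (suc n)
  +-homo (-[1+ m ]) (+ n)      = trans (⊖-homo n (suc m)) (+-comm _ _)
  +-homo (-[1+ m ]) (-[1+ n ]) = begin
    - (suc (suc (m ℕ.+ n)) · 1#)        ≡⟨ ≡.cong (λ k → - (suc k · 1#)) (ℕ.+-suc m n) ⟨
    - ((suc m ℕ.+ suc n) · 1#)          ≈⟨ -‿cong (×-homo-+ 1# (suc m) (suc n)) ⟩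
    - (suc m · 1# + suc n · 1#)         ≈⟨ -‿+-comm _ _ ⟨
    - (suc m · 1#) - suc n · 1#         ∎

  *-homo-+ : ∀ m j → ⟦ + m ℤ.* j ⟧ ≈ ⟦ + m ⟧ * ⟦ j ⟧
  *-homo-+ m (+ n)      = begin
    ⟦ + m ℤ.* + n ⟧                     ≡⟨ ≡.cong ⟦_⟧ (ℤ.pos-* m n) ⟨
    (m ℕ.* n) · 1#                      ≈⟨ ×1-homo-* m n ⟩
    m · 1# * (n · 1#)                   ∎
  *-homo-+ m (-[1+ n ]) = begin
    ⟦ + m ℤ.* (ℤ.- (+ suc n)) ⟧         ≡⟨ ≡.cong ⟦_⟧ (ℤ.neg-distribʳ-* (+ m) (+ suc n)) ⟨
    ⟦ ℤ.- (+ m ℤ.* + suc n) ⟧           ≈⟨ neg-homo (+ m ℤ.* + suc n) ⟩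
    - ⟦ + m ℤ.* + suc n ⟧               ≈⟨ -‿cong (*-homo-+ m (+ suc n)) ⟩
    - (m · 1# * (suc n · 1#))           ≈⟨ -‿distribʳ-* _ _ ⟩
    m · 1# * - (suc n · 1#)             ∎

  *-homo : ∀ i j → ⟦ i ℤ.* j ⟧ ≈ ⟦ i ⟧ * ⟦ j ⟧
  *-homo (+ m)      j = *-homo-+ m j
  *-homo (-[1+ m ]) j = begin
    ⟦ (ℤ.- (+ suc m)) ℤ.* j ⟧           ≡⟨ ≡.cong ⟦_⟧ (ℤ.neg-distribˡ-* (+ suc m) j) ⟨
    ⟦ ℤ.- (+ suc m ℤ.* j) ⟧             ≈⟨ neg-homo (+ suc m ℤ.* j) ⟩
    - ⟦ + suc m ℤ.* j ⟧                 ≈⟨ -‿cong (*-homo-+ (suc m) j) ⟩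
    - (suc m · 1# * ⟦ j ⟧)              ≈⟨ -‿distribˡ-* _ _ ⟩
    - (suc m · 1#) * ⟦ j ⟧              ∎

  -- Arithmetic in an abstract field does not reduce; coefficients in ℤ do, which lets the solver
  -- cancel opposite terms.
  homomorphism : ℤ.+-*-rawRing -Raw-AlmostCommutative⟶ fromCommutativeRing R
  homomorphism = record
    { ⟦_⟧    = ⟦_⟧
    ; +-homo = +-homo
    ; *-homo = *-homo
    ; -‿homo = neg-homo
    ; 0-homo = refl
    ; 1-homo = refl
    }

  open RingSolver ℤ.+-*-rawRing (fromCommutativeRing R) homomorphism
    (λ i j → Maybe.map (λ i≡j → reflexive (≡.cong ⟦_⟧ i≡j)) (dec⇒maybe (i ℤ.≟ j))) public
    using (Polynomial; solve; con; _:=_; _:+_; _:*_; _:-_; :-_)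

  :0 :1 : ∀ {n} → Polynomial n
  :0 = con (+ 0)
  :1 = con (+ 1)

-- Double counting of pairs (cofactor, divisor).

∑ : (ℕ → ℕ) → ℕ → ℕ
∑ f zero    = 0
∑ f (suc n) = ∑ f n ℕ.+ f n

𝟙 : ∀ {p} {P : Set p} → Dec P → ℕ
𝟙 P? = if does P? then 1 else 0

𝟙-true : ∀ {p} {P : Set p} (P? : Dec P) → P → 𝟙 P? ≡ 1
𝟙-true P? p = ≡.cong (if_then 1 else 0) (dec-true P? p)

𝟙-false : ∀ {p} {P : Set p} (P? : Dec P) → ¬ P → 𝟙 P? ≡ 0
𝟙-false P? ¬p = ≡.cong (if_then 1 else 0) (dec-false P? ¬p)

module _ where
  open ≡.≡-Reasoning
  open CommutativeSemigroupProperties ℕ.+-commutativeSemigroup using (interchange)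

  ∑-cong : ∀ {f g} → (∀ i → f i ≡ g i) → ∀ n → ∑ f n ≡ ∑ g n
  ∑-cong f≗g zero    = ≡.refl
  ∑-cong f≗g (suc n) = ≡.cong₂ ℕ._+_ (∑-cong f≗g n) (f≗g n)

  ∑-zero : ∀ {f} → (∀ i → f i ≡ 0) → ∀ n → ∑ f n ≡ 0
  ∑-zero f≗0 zero    = ≡.refl
  ∑-zero f≗0 (suc n) = ≡.cong₂ ℕ._+_ (∑-zero f≗0 n) (f≗0 n)

  ∑-+ : ∀ f g n → ∑ (λ i → f i ℕ.+ g i) n ≡ ∑ f n ℕ.+ ∑ g n
  ∑-+ f g zero    = ≡.refl
  ∑-+ f g (suc n) = ≡.trans (≡.cong (ℕ._+ (f n ℕ.+ g n)) (∑-+ f g n)) (interchange (∑ f n) _ _ _)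

  ∑-*ʳ : ∀ f c n → ∑ (λ i → f i ℕ.* c) n ≡ ∑ f n ℕ.* c
  ∑-*ʳ f c zero    = ≡.refl
  ∑-*ʳ f c (suc n) = ≡.trans (≡.cong (ℕ._+ f n ℕ.* c) (∑-*ʳ f c n)) (≡.sym (ℕ.*-distribʳ-+ c (∑ f n) (f n)))

  ∑-comm : ∀ (f : ℕ → ℕ → ℕ) m n → ∑ (λ i → ∑ (f i) n) m ≡ ∑ (λ j → ∑ (λ i → f i j) m) n
  ∑-comm f zero    n = ≡.sym (∑-zero (λ _ → ≡.refl) n)
  ∑-comm f (suc m) n = begin
    ∑ (λ i → ∑ (f i) n) m ℕ.+ ∑ (f m) n            ≡⟨ ≡.cong (ℕ._+ ∑ (f m) n) (∑-comm f m n) ⟩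
    ∑ (λ j → ∑ (λ i → f i j) m) n ℕ.+ ∑ (f m) n    ≡⟨ ∑-+ _ _ n ⟨
    ∑ (λ j → ∑ (λ i → f i j) (suc m)) n            ∎

  ∑-extend : ∀ {f m n} → m ℕ.≤′ n → (∀ i → m ℕ.≤ i → f i ≡ 0) → ∑ f n ≡ ∑ f m
  ∑-extend ℕ.≤′-refl       tail≡0 = ≡.refl
  ∑-extend (ℕ.≤′-step m≤n) tail≡0 =
    ≡.trans (≡.cong₂ ℕ._+_ (∑-extend m≤n tail≡0) (tail≡0 _ (ℕ.≤′⇒≤ m≤n))) (ℕ.+-identityʳ _)

  ∑-single : ∀ {f} k {n} → k ℕ.< n → (∀ i → i ≢ k → f i ≡ 0) → ∑ f n ≡ f k
  ∑-single {f} k {n} k<n others≡0 = begin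
    ∑ f n            ≡⟨ ∑-extend (ℕ.≤⇒≤′ k<n) (λ i k<i → others≡0 i (ℕ.>⇒≢ k<i)) ⟩
    ∑ f k ℕ.+ f k    ≡⟨ ≡.cong (ℕ._+ f k) (∑-below k ℕ.≤-refl) ⟩
    f k              ∎
    where
    ∑-below : ∀ j → j ℕ.≤ k → ∑ f j ≡ 0
    ∑-below zero    _   = ≡.refl
    ∑-below (suc j) j<k = ≡.cong₂ ℕ._+_ (∑-below j (ℕ.<⇒≤ j<k)) (others≡0 j (ℕ.<⇒≢ j<k))

  sum-map-1⋯ : ∀ f n → sum (map f (1⋯ n)) ≡ ∑ (f ∘ suc) n
  sum-map-1⋯ f n = ≡.trans (≡.cong sum (≡.sym (map-∘ (upTo n)))) (sum-map-upTo n)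
    where
    sum-map-upTo : ∀ n → sum (map (f ∘ suc) (upTo n)) ≡ ∑ (f ∘ suc) n
    sum-map-upTo zero    = ≡.refl
    sum-map-upTo (suc n) = begin
      sum (map g (upTo (suc n)))                     ≡⟨ ≡.cong (sum ∘ map g) (upTo-∷ʳ n) ⟨
      sum (map g (upTo n ∷ʳ n))       ≡⟨ ≡.cong sum (map-++ g (upTo n) (n ∷ [])) ⟩
      sum (map g (upTo n) ∷ʳ g n)     ≡⟨ sum-++ (map g (upTo n)) (g n ∷ []) ⟩
      sum (map g (upTo n)) ℕ.+ (g n ℕ.+ 0)           ≡⟨ ≡.cong₂ ℕ._+_ (sum-map-upTo n) (ℕ.+-identityʳ (g n)) ⟩
      ∑ g n ℕ.+ g n                                  ∎
      where g = f ∘ suc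

  sum-filter : ∀ {p} {P : Pred ℕ p} (P? : Decidable P) ns →
               sum (filter P? ns) ≡ sum (map (λ n → 𝟙 (P? n) ℕ.* n) ns)
  sum-filter P? []       = ≡.refl
  sum-filter P? (n ∷ ns) with does (P? n)
  ... | true  = ≡.cong₂ ℕ._+_ (≡.sym (ℕ.+-identityʳ n)) (sum-filter P? ns)
  ... | false = sum-filter P? ns

  -- A divisor of `n` is at most `n`, so the terms past `n` vanish. A bound `N` that does not depend
  -- on `n` makes the later interchange of sums one over a square.
  σ≡∑ : ∀ n .{{_ : NonZero n}} {N} → n ℕ.≤ N → σ n ≡ ∑ (λ i → 𝟙 (suc i ∣? n) ℕ.* suc i) N
  σ≡∑ n {N} n≤N = begin
    σ n                                       ≡⟨ sum-filter (_∣? n) (1⋯ n) ⟩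
    sum (map (λ d → 𝟙 (d ∣? n) ℕ.* d) (1⋯ n)) ≡⟨ sum-map-1⋯ _ n ⟩
    ∑ (λ i → 𝟙 (suc i ∣? n) ℕ.* suc i) n      ≡⟨ ∑-extend (ℕ.≤⇒≤′ n≤N) (λ i n≤i →
                                                   ≡.cong (ℕ._* suc i) (𝟙-false (suc i ∣? n) λ d∣n →
                                                     ℕ.<⇒≱ (s≤s n≤i) (∣⇒≤ d∣n))) ⟨
    ∑ (λ i → 𝟙 (suc i ∣? n) ℕ.* suc i) N      ∎

  -- A divisor of a nonzero number has exactly one cofactor, which is positive and at most `n`;
  -- hence the sum of indicators is 0 or 1.
  𝟙-∣ : ∀ d .{{_ : NonZero d}} n .{{_ : NonZero n}} {N} → n ℕ.≤ N →
        𝟙 (d ∣? n) ≡ ∑ (λ j → 𝟙 (suc j ℕ.* d ℕ.≟ n)) N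
  𝟙-∣ d n {N} n≤N with d ∣? n
  ... | no  d∤n = ≡.sym (∑-zero (λ j → 𝟙-false (suc j ℕ.* d ℕ.≟ n) λ eq → d∤n (divides (suc j) (≡.sym eq))) N)
  ... | yes (divides zero n≡0) = contradiction n≡0 (ℕ.≢-nonZero⁻¹ n)
  ... | yes (divides (suc k) n≡kd) = begin
    1                                         ≡⟨ 𝟙-true (suc k ℕ.* d ℕ.≟ n) (≡.sym n≡kd) ⟨
    𝟙 (suc k ℕ.* d ℕ.≟ n)                     ≡⟨ ∑-single k k<N (λ j j≢k → 𝟙-false (suc j ℕ.* d ℕ.≟ n) λ eq →
                                                   j≢k (ℕ.suc-injective (ℕ.*-cancelʳ-≡ (suc j) (suc k) d (≡.trans eq n≡kd)))) ⟨
    ∑ (λ j → 𝟙 (suc j ℕ.* d ℕ.≟ n)) N         ∎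
    where
    k<N : suc k ℕ.≤ N
    k<N = ℕ.≤-trans (ℕ.m≤m*n (suc k) d) (ℕ.≤-trans (ℕ.≤-reflexive (≡.sym n≡kd)) n≤N)

  𝟙-≤-suc : ∀ k m → 𝟙 (k ℕ.≤? suc m) ≡ 𝟙 (k ℕ.≤? m) ℕ.+ 𝟙 (k ℕ.≟ suc m)
  𝟙-≤-suc k m with ℕ.<-cmp k (suc m)
  ... | tri< k<1+m k≢1+m _ = begin
    𝟙 (k ℕ.≤? suc m)                    ≡⟨ 𝟙-true (k ℕ.≤? suc m) (ℕ.<⇒≤ k<1+m) ⟩
    1                                   ≡⟨ ≡.cong₂ ℕ._+_ (𝟙-true (k ℕ.≤? m) (ℕ.s≤s⁻¹ k<1+m)) (𝟙-false (k ℕ.≟ suc m) k≢1+m) ⟨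
    𝟙 (k ℕ.≤? m) ℕ.+ 𝟙 (k ℕ.≟ suc m)    ∎
  ... | tri≈ k≮1+m k≡1+m _ = begin
    𝟙 (k ℕ.≤? suc m)                    ≡⟨ 𝟙-true (k ℕ.≤? suc m) (ℕ.≤-reflexive k≡1+m) ⟩
    1                                   ≡⟨ ≡.cong₂ ℕ._+_ (𝟙-false (k ℕ.≤? m) (k≮1+m ∘ s≤s)) (𝟙-true (k ℕ.≟ suc m) k≡1+m) ⟨
    𝟙 (k ℕ.≤? m) ℕ.+ 𝟙 (k ℕ.≟ suc m)    ∎
  ... | tri> k≮1+m k≢1+m k>1+m = begin
    𝟙 (k ℕ.≤? suc m)                    ≡⟨ 𝟙-false (k ℕ.≤? suc m) (ℕ.<⇒≱ k>1+m) ⟩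
    0                                   ≡⟨ ≡.cong₂ ℕ._+_ (𝟙-false (k ℕ.≤? m) (k≮1+m ∘ s≤s)) (𝟙-false (k ℕ.≟ suc m) k≢1+m) ⟨
    𝟙 (k ℕ.≤? m) ℕ.+ 𝟙 (k ℕ.≟ suc m)    ∎

  -- Induction on the cutoff with `N` fixed: passing from `m` to `suc m` admits exactly the pairs
  -- with product `suc m`, and their divisors add up to `σ (suc m)`.
  ∑σ : ∀ {N} m → m ℕ.≤ N →
       ∑ (σ ∘ suc) m ≡ ∑ (λ j → ∑ (λ i → 𝟙 (suc j ℕ.* suc i ℕ.≤? m) ℕ.* suc i) N) N
  ∑σ {N} zero    _   = ≡.sym (∑-zero (λ j → ∑-zero (λ i → ≡.refl) N) N)
  ∑σ {N} (suc m) m<N = begin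
    ∑ (σ ∘ suc) m ℕ.+ σ (suc m)
      ≡⟨ ≡.cong₂ ℕ._+_ (∑σ m (ℕ.<⇒≤ m<N)) σ-as-pairs ⟩
    ∑ (λ j → ∑ (λ i → below j i ℕ.* suc i) N) N ℕ.+ ∑ (λ j → ∑ (λ i → equal j i ℕ.* suc i) N) N
      ≡⟨ ∑-+ _ _ N ⟨
    ∑ (λ j → ∑ (λ i → below j i ℕ.* suc i) N ℕ.+ ∑ (λ i → equal j i ℕ.* suc i) N) N
      ≡⟨ ∑-cong (λ j → ≡.trans (≡.sym (∑-+ _ _ N)) (∑-cong (λ i →
           ≡.trans (≡.sym (ℕ.*-distribʳ-+ (suc i) (below j i) (equal j i)))
             (≡.cong (ℕ._* suc i) (≡.sym (𝟙-≤-suc (suc j ℕ.* suc i) m)))) N)) N ⟩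
    ∑ (λ j → ∑ (λ i → 𝟙 (suc j ℕ.* suc i ℕ.≤? suc m) ℕ.* suc i) N) N
      ∎
    where
    below equal : ℕ → ℕ → ℕ
    below j i = 𝟙 (suc j ℕ.* suc i ℕ.≤? m)
    equal j i = 𝟙 (suc j ℕ.* suc i ℕ.≟ suc m)

    σ-as-pairs : σ (suc m) ≡ ∑ (λ j → ∑ (λ i → equal j i ℕ.* suc i) N) N
    σ-as-pairs = begin
      σ (suc m)                                           ≡⟨ σ≡∑ (suc m) m<N ⟩
      ∑ (λ i → 𝟙 (suc i ∣? suc m) ℕ.* suc i) N            ≡⟨ ∑-cong (λ i → ≡.cong (ℕ._* suc i) (𝟙-∣ (suc i) (suc m) m<N)) N ⟩
      ∑ (λ i → ∑ (λ j → equal j i) N ℕ.* suc i) N         ≡⟨ ∑-cong (λ i → ∑-*ʳ (λ j → equal j i) (suc i) N) N ⟨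
      ∑ (λ i → ∑ (λ j → equal j i ℕ.* suc i) N) N         ≡⟨ ∑-comm (λ j i → equal j i ℕ.* suc i) N N ⟨
      ∑ (λ j → ∑ (λ i → equal j i ℕ.* suc i) N) N         ∎

-- Ordered-field inequalities.

module Analysis {ℓ : Level} (ℝ : CompleteOrderedField ℓ) where
  open RealAnalysis ℝ
  open IntegerCoefficients commutativeRing
    using (solve; _:=_; _:+_; _:*_; _:-_; :-_; :0; :1)
  open Mult semiring using () renaming (×-homo-+ to ·-homo-+; ×1-homo-* to ·1-homo-*)
  open ≤-Reasoning

  ≤-from-gap : ∀ {x y d} → 0# ≤ d → x + d ≈ y → x ≤ y
  ≤-from-gap 0≤d x+d≈y = ≤-trans (x≤x+y _ 0≤d) (inj₂ x+d≈y)

  +-mono-≤ : ∀ {w x y z} → w ≤ x → y ≤ z → w + y ≤ x + z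
  +-mono-≤ w≤x y≤z = ≤-trans (+-monoˡ-≤ _ w≤x) (+-monoʳ-≤ _ y≤z)

  0≤y-x : ∀ {x y} → x ≤ y → 0# ≤ y - x
  0≤y-x {x} {y} x≤y = begin
    0#      ≈⟨ -‿inverseʳ x ⟨
    x - x   ≤⟨ +-monoˡ-≤ (- x) x≤y ⟩
    y - x   ∎

  <-≤-connex : ∀ x y → x < y ⊎ y ≤ x
  <-≤-connex x y with x <? y
  ... | yes x<y = inj₁ x<y
  ... | no  x≮y = inj₂ (≮⇒≥ x≮y)

  0<y-x : ∀ {x y} → x < y → 0# < y - x
  0<y-x {x} {y} x<y = begin-strict
    0#      ≈⟨ -‿inverseʳ x ⟨
    x - x   <⟨ +-monoˡ-< (- x) x<y ⟩
    y - x   ∎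

  -‿antimono-≤ : ∀ {x y} → x ≤ y → - y ≤ - x
  -‿antimono-≤ {x} {y} x≤y = ≤-from-gap (0≤y-x x≤y)
    (solve 2 (λ x y → :- y :+ (y :- x) := :- x) refl x y)

  *-nonneg : ∀ {x y} → 0# ≤ x → 0# ≤ y → 0# ≤ x * y
  *-nonneg         (inj₁ 0<x) (inj₁ 0<y) = inj₁ (*-pos 0<x 0<y)
  *-nonneg {x}     _          (inj₂ 0≈y) = inj₂ (trans (sym (zeroʳ x)) (*-congˡ 0≈y))
  *-nonneg {y = y} (inj₂ 0≈x) _          = inj₂ (trans (sym (zeroˡ y)) (*-congʳ 0≈x))

  *-monoʳ-≤-nonneg : ∀ {z} → 0# ≤ z → ∀ {x y} → x ≤ y → z * x ≤ z * y
  *-monoʳ-≤-nonneg (inj₁ 0<z) x≤y = *-monoʳ-≤ 0<z x≤y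
  *-monoʳ-≤-nonneg {z} (inj₂ 0≈z) {x} {y} _ = inj₂ (begin-equality
    z * x    ≈⟨ *-congʳ 0≈z ⟨
    0# * x   ≈⟨ trans (zeroˡ x) (sym (zeroˡ y)) ⟩
    0# * y   ≈⟨ *-congʳ 0≈z ⟩
    z * y    ∎)

  *-mono-≤ : ∀ {w x y z} → 0# ≤ w → 0# ≤ y → w ≤ x → y ≤ z → w * y ≤ x * z
  *-mono-≤ {w} {x} {y} {z} 0≤w 0≤y w≤x y≤z = begin
    w * y   ≤⟨ *-monoʳ-≤-nonneg 0≤w y≤z ⟩
    w * z   ≈⟨ *-comm w z ⟩
    z * w   ≤⟨ *-monoʳ-≤-nonneg (≤-trans 0≤y y≤z) w≤x ⟩
    z * x   ≈⟨ *-comm z x ⟩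
    x * z   ∎

  *-monoˡ-≤-nonneg : ∀ {z} → 0# ≤ z → ∀ {x y} → x ≤ y → x * z ≤ y * z
  *-monoˡ-≤-nonneg {z} 0≤z {x} {y} x≤y = begin
    x * z   ≈⟨ *-comm x z ⟩
    z * x   ≤⟨ *-monoʳ-≤-nonneg 0≤z x≤y ⟩
    z * y   ≈⟨ *-comm z y ⟩
    y * z   ∎

  square-nonneg : ∀ x → 0# ≤ x * x
  square-nonneg x with compare 0# x
  ... | tri< 0<x _ _ = inj₁ (*-pos 0<x 0<x)
  ... | tri≈ _ 0≈x _ = *-nonneg (inj₂ 0≈x) (inj₂ 0≈x)
  ... | tri> _ _ x<0 = ≤-trans (*-nonneg 0≤-x 0≤-x)
    (inj₂ (solve 1 (λ x → (:0 :- x) :* (:0 :- x) := x :* x) refl x))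
    where 0≤-x = 0≤y-x (inj₁ x<0)

  0<1≤ : ∀ {x} → 1# ≤ x → 0# < x
  0<1≤ {x} 1≤x = begin-strict 0# <⟨ 0<1 ⟩ 1# ≤⟨ 1≤x ⟩ x ∎

  x*x⁻¹≈1 : ∀ {x} → 0# < x → x * x ⁻¹ ≈ 1#
  x*x⁻¹≈1 0<x = ⁻¹-inverse (0<⇒≉0 0<x)

  ⁻¹-unique : ∀ {x y} → 0# < x → x * y ≈ 1# → x ⁻¹ ≈ y
  ⁻¹-unique {x} {y} 0<x xy≈1 = begin-equality
    x ⁻¹              ≈⟨ *-identityʳ _ ⟨
    x ⁻¹ * 1#         ≈⟨ *-congˡ xy≈1 ⟨
    x ⁻¹ * (x * y)    ≈⟨ solve 3 (λ u x y → u :* (x :* y) := (x :* u) :* y) refl (x ⁻¹) x y ⟩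
    x * x ⁻¹ * y      ≈⟨ *-congʳ (x*x⁻¹≈1 0<x) ⟩
    1# * y            ≈⟨ *-identityˡ y ⟩
    y                 ∎

  ⁻¹-distrib-* : ∀ {x y} → 0# < x → 0# < y → (x * y) ⁻¹ ≈ x ⁻¹ * y ⁻¹
  ⁻¹-distrib-* {x} {y} 0<x 0<y = ⁻¹-unique (*-pos 0<x 0<y) (begin-equality
    x * y * (x ⁻¹ * y ⁻¹)     ≈⟨ solve 4 (λ x y u v → x :* y :* (u :* v) := (x :* u) :* (y :* v)) refl x y (x ⁻¹) (y ⁻¹) ⟩
    x * x ⁻¹ * (y * y ⁻¹)     ≈⟨ *-cong (x*x⁻¹≈1 0<x) (x*x⁻¹≈1 0<y) ⟩
    1# * 1#                   ≈⟨ *-identityˡ 1# ⟩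
    1#                        ∎)

  -- Finite sums in the field, and closeness up to an error.

  partialSum-cong : ∀ {a b} → (∀ i → a i ≈ b i) → ∀ n → partialSum a n ≈ partialSum b n
  partialSum-cong a≈b zero    = refl
  partialSum-cong a≈b (suc n) = +-cong (partialSum-cong a≈b n) (a≈b n)

  partialSum-mono-≤ : ∀ {a b} → (∀ i → a i ≤ b i) → ∀ n → partialSum a n ≤ partialSum b n
  partialSum-mono-≤ a≤b zero    = ≤-refl
  partialSum-mono-≤ a≤b (suc n) = +-mono-≤ (partialSum-mono-≤ a≤b n) (a≤b n)

  partialSum-nonneg : ∀ {a} → (∀ i → 0# ≤ a i) → ∀ n → 0# ≤ partialSum a n
  partialSum-nonneg 0≤a n = partialSum-mono 0≤a (ℕ.≤⇒≤′ (z≤n {n}))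

  partialSum-*ʳ : ∀ a c n → partialSum a n * c ≈ partialSum (λ i → a i * c) n
  partialSum-*ʳ a c zero    = zeroˡ c
  partialSum-*ʳ a c (suc n) = trans (distribʳ c _ _) (+-congʳ (partialSum-*ʳ a c n))

  fromℕ-∑ : ∀ f n → fromℕ (∑ f n) ≈ partialSum (fromℕ ∘ f) n
  fromℕ-∑ f zero    = refl
  fromℕ-∑ f (suc n) = trans (·-homo-+ 1# (∑ f n) (f n)) (+-congʳ (fromℕ-∑ f n))

  -- Not strict, unlike `_≈[_]_`: errors may then be 0, add up, and be scaled by a factor that is
  -- only nonnegative.
  Within : Carrier → Carrier → Carrier → Set ℓ
  Within e x y = x ≤ y + e × y ≤ x + e

  within-cong : ∀ {e e′ x x′ y y′} → e ≈ e′ → x ≈ x′ → y ≈ y′ → Within e x y → Within e′ x′ y′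
  within-cong {e} {e′} {x} {x′} {y} {y′} e≈ x≈ y≈ (x≤ , y≤) =
    (begin x′ ≈⟨ x≈ ⟨ x ≤⟨ x≤ ⟩ y + e ≈⟨ +-cong y≈ e≈ ⟩ y′ + e′ ∎) ,
    (begin y′ ≈⟨ y≈ ⟨ y ≤⟨ y≤ ⟩ x + e ≈⟨ +-cong x≈ e≈ ⟩ x′ + e′ ∎)

  within-weaken : ∀ {e e′ x y} → e ≤ e′ → Within e x y → Within e′ x y
  within-weaken e≤e′ (x≤ , y≤) = ≤-trans x≤ (+-monoʳ-≤ _ e≤e′) , ≤-trans y≤ (+-monoʳ-≤ _ e≤e′)

  within-refl : ∀ {x} → Within 0# x x
  within-refl = inj₂ (sym (+-identityʳ _)) , inj₂ (sym (+-identityʳ _))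

  within-+ : ∀ {e e′ x x′ y y′} → Within e x y → Within e′ x′ y′ → Within (e + e′) (x + x′) (y + y′)
  within-+ {e} {e′} {x} {x′} {y} {y′} (x≤ , y≤) (x′≤ , y′≤) =
    ≤-trans (+-mono-≤ x≤ x′≤) (inj₂ (interchange y e y′ e′)) ,
    ≤-trans (+-mono-≤ y≤ y′≤) (inj₂ (interchange x e x′ e′))
    where interchange = solve 4 (λ y e y′ e′ → (y :+ e) :+ (y′ :+ e′) := (y :+ y′) :+ (e :+ e′)) refl

  within-* : ∀ {c e x y} → 0# ≤ c → Within e x y → Within (c * e) (c * x) (c * y)
  within-* 0≤c (x≤ , y≤) =
    ≤-trans (*-monoʳ-≤-nonneg 0≤c x≤) (inj₂ (distribˡ _ _ _)) ,
    ≤-trans (*-monoʳ-≤-nonneg 0≤c y≤) (inj₂ (distribˡ _ _ _))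

  within-interval : ∀ {lo hi x y} → lo ≤ x → x ≤ hi → lo ≤ y → y ≤ hi → Within (hi - lo) x y
  within-interval {lo} {hi} lo≤x x≤hi lo≤y y≤hi = close lo≤y x≤hi , close lo≤x y≤hi
    where
    close : ∀ {x y} → lo ≤ y → x ≤ hi → x ≤ y + (hi - lo)
    close {x} {y} lo≤y x≤hi = begin
      x                 ≤⟨ x≤hi ⟩
      hi                ≈⟨ y+[x-y]≈x hi lo ⟨
      lo + (hi - lo)    ≤⟨ +-monoˡ-≤ _ lo≤y ⟩
      y + (hi - lo)     ∎

  -- G is an antiderivative of f up to an error controlled by the variation
  -- function V. The error (V m - V a) * (m - a) telescopes along a partition to
  -- at most (V b - V 1) * δ, which makes f integrable; jumps of f are jumps of V.
  record Controlled (b : Carrier) (f G V : Carrier → Carrier) : Set ℓ where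
    field
      variation-mono : ∀ {a m} → 1# ≤ a → a ≤ m → m ≤ b → V a ≤ V m
      cell-error     : ∀ {a t m} → 1# ≤ a → a ≤ t → t ≤ m → m ≤ b →
                       Within ((V m - V a) * (m - a)) (f t * (m - a)) (G m - G a)

  open Controlled

  -- Riemann integrability of controlled functions.

  partition-≤ : ∀ {a b} → TaggedPartition a b → a ≤ b
  partition-≤ (end a≈b)             = inj₂ a≈b
  partition-≤ (cell m t a≤t t≤m P) = ≤-trans a≤t (≤-trans t≤m (partition-≤ P))

  module _ {b : Carrier} where

    riemannSum-error : ∀ {f G V} → Controlled b f G V → ∀ {δ} → 0# < δ → ∀ {a} → 1# ≤ a →
                       (P : TaggedPartition a b) → MeshBelow δ P →
                       Within ((V b - V a) * δ) (riemannSum f P) (G b - G a)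
    riemannSum-error {f} {G} {V} C {δ} 0<δ {a} 1≤a (end a≈b) _ =
      -- `G` is not assumed to respect `≈`, so `a ≈ b` alone does not make `G b - G a` vanish;
      -- `cell-error` on the degenerate cell from `a` to `b` does.
      within-weaken (*-nonneg (0≤y-x (variation-mono C 1≤a (inj₂ a≈b) ≤-refl)) (inj₁ 0<δ))
        (within-cong (vanish _) (vanish _) refl (cell-error C 1≤a ≤-refl (inj₂ a≈b) ≤-refl))
      where
      vanish : ∀ y → y * (b - a) ≈ 0#
      vanish y = begin-equality
        y * (b - a)   ≈⟨ *-congˡ (+-congʳ a≈b) ⟨
        y * (a - a)   ≈⟨ solve 2 (λ y a → y :* (a :- a) := :0) refl y a ⟩
        0#            ∎
    riemannSum-error {f} {G} {V} C {δ} 0<δ {a} 1≤a (cell m t a≤t t≤m P) (m-a<δ , mesh) =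
      within-cong
        (solve 4 (λ va vm vb δ → (vm :- va) :* δ :+ (vb :- vm) :* δ := (vb :- va) :* δ) refl (V a) (V m) (V b) δ)
        refl
        (solve 3 (λ ga gm gb → (gm :- ga) :+ (gb :- gm) := gb :- ga) refl (G a) (G m) (G b))
        (within-+
          (within-weaken (*-monoʳ-≤-nonneg (0≤y-x (variation-mono C 1≤a a≤m m≤b)) (inj₁ m-a<δ))
            (cell-error C 1≤a a≤t t≤m m≤b))
          (riemannSum-error C 0<δ (≤-trans 1≤a a≤m) P mesh))
      where
      a≤m = ≤-trans a≤t t≤m
      m≤b = partition-≤ P

    controlled⇒integral : ∀ {f G V} → 1# ≤ b → Controlled b f G V → IsIntegral 1# b f (G b - G 1#)
    controlled⇒integral {f} {G} {V} 1≤b C ε 0<ε = δ , 0<δ , λ P mesh →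
      let (R≤ , ≤R) = riemannSum-error C 0<δ ≤-refl P mesh in
      x<y+z⇒x-y<z (below R≤) , x<y+z⇒x-y<z (below ≤R)
      where
      v w δ : Carrier
      v = V b - V 1#
      -- Adding 1 keeps the denominator positive when `v` is 0 and makes `v * δ < ε` strict.
      w = v + 1#
      δ = ε * w ⁻¹

      0<w : 0# < w
      0<w = begin-strict
        0#        <⟨ 0<1 ⟩
        1#        ≤⟨ x≤x+y 1# (0≤y-x (variation-mono C ≤-refl 1≤b ≤-refl)) ⟩
        1# + v    ≈⟨ +-comm 1# v ⟩
        w         ∎

      0<δ : 0# < δ
      0<δ = *-pos 0<ε (⁻¹-pos 0<w)

      vδ<ε : v * δ < ε
      vδ<ε = begin-strict
        v * δ               ≈⟨ +-identityʳ _ ⟨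
        v * δ + 0#          <⟨ +-monoʳ-< _ 0<δ ⟩
        v * δ + δ           ≈⟨ solve 3 (λ v ε u → v :* (ε :* u) :+ ε :* u := ε :* ((v :+ :1) :* u)) refl v ε (w ⁻¹) ⟩
        ε * (w * w ⁻¹)      ≈⟨ *-congˡ (x*x⁻¹≈1 0<w) ⟩
        ε * 1#              ≈⟨ *-identityʳ ε ⟩
        ε                   ∎

      below : ∀ {x y} → x ≤ y + v * δ → x < y + ε
      below {x} {y} x≤ = begin-strict x ≤⟨ x≤ ⟩ y + v * δ <⟨ +-monoʳ-< y vδ<ε ⟩ y + ε ∎

    -- Agreement on [1 , b] is enough because every tag of a cell lies there; the formula for `𝒟`
    -- below holds only on such an interval.
    controlled-cong : ∀ {f g G V} → (∀ {t} → 1# ≤ t → t ≤ b → f t ≈ g t) →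
                      Controlled b f G V → Controlled b g G V
    controlled-cong f≈g C = record
      { variation-mono = variation-mono C
      ; cell-error     = λ 1≤a a≤t t≤m m≤b →
          within-cong refl (*-congʳ (f≈g (≤-trans 1≤a a≤t) (≤-trans t≤m m≤b))) refl
            (cell-error C 1≤a a≤t t≤m m≤b)
      }

    controlled-const : ∀ c → Controlled b (λ _ → c) (c *_) (λ _ → 0#)
    controlled-const c = record
      { variation-mono = λ _ _ _ → ≤-refl
      ; cell-error     = λ {a} {_} {m} _ _ _ _ → within-cong
          (solve 2 (λ a m → :0 := (:0 :- :0) :* (m :- a)) refl a m) refl
          (solve 3 (λ a m c → c :* (m :- a) := c :* m :- c :* a) refl a m c) within-refl
      }

    controlled-+ : ∀ {f f′ G G′ V V′} → Controlled b f G V → Controlled b f′ G′ V′ →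
                   Controlled b (λ t → f t + f′ t) (λ t → G t + G′ t) (λ t → V t + V′ t)
    controlled-+ {f} {f′} {G} {G′} {V} {V′} C C′ = record
      { variation-mono = λ 1≤a a≤m m≤b → +-mono-≤ (variation-mono C 1≤a a≤m m≤b) (variation-mono C′ 1≤a a≤m m≤b)
      ; cell-error     = λ {a} {t} {m} 1≤a a≤t t≤m m≤b → within-cong
          (solve 5 (λ x y z w d → (x :- y) :* d :+ (z :- w) :* d := ((x :+ z) :- (y :+ w)) :* d) refl
            (V m) (V a) (V′ m) (V′ a) (m - a))
          (sym (distribʳ _ _ _))
          (solve 4 (λ x y z w → (x :- y) :+ (z :- w) := (x :+ z) :- (y :+ w)) refl (G m) (G a) (G′ m) (G′ a))
          (within-+ (cell-error C 1≤a a≤t t≤m m≤b) (cell-error C′ 1≤a a≤t t≤m m≤b))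
      }

    controlled-* : ∀ {c f G V} → 0# ≤ c → Controlled b f G V →
                   Controlled b (λ t → c * f t) (λ t → c * G t) (λ t → c * V t)
    controlled-* {c} {f} {G} {V} 0≤c C = record
      { variation-mono = λ 1≤a a≤m m≤b → *-monoʳ-≤-nonneg 0≤c (variation-mono C 1≤a a≤m m≤b)
      ; cell-error     = λ {a} {t} {m} 1≤a a≤t t≤m m≤b → within-cong
          (solve 4 (λ c x y d → c :* ((x :- y) :* d) := (c :* x :- c :* y) :* d) refl c (V m) (V a) (m - a))
          (sym (*-assoc _ _ _))
          (solve 3 (λ c x y → c :* (x :- y) := c :* x :- c :* y) refl c (G m) (G a))
          (within-* 0≤c (cell-error C 1≤a a≤t t≤m m≤b))
      }

    controlled-partialSum : ∀ {f G V : ℕ → Carrier → Carrier} → (∀ i → Controlled b (f i) (G i) (V i)) → ∀ n →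
                            Controlled b (λ t → partialSum (λ i → f i t) n)
                                         (λ t → partialSum (λ i → G i t) n)
                                         (λ t → partialSum (λ i → V i t) n)
    controlled-partialSum C zero    = record
      { variation-mono = λ _ _ _ → ≤-refl
      ; cell-error     = λ {a} {_} {m} _ _ _ _ → within-cong
          (solve 2 (λ a m → :0 := (:0 :- :0) :* (m :- a)) refl a m)
          (sym (zeroˡ (m - a)))
          (sym (-‿inverseʳ 0#))
          within-refl
      }
    controlled-partialSum C (suc n) = controlled-+ (controlled-partialSum C n) (C n)

  -- The steps [p ≤ t] / t².

  from : Carrier → (Carrier → Carrier) → Carrier → Carrier
  from p f t with t <? p
  ... | yes _ = 0#
  ... | no  _ = f t

  from-< : ∀ {p f t} → t < p → from p f t ≈ 0#
  from-< {p} {f} {t} t<p with t <? p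
  ... | yes _   = refl
  ... | no  t≮p = contradiction t<p t≮p

  from-≥ : ∀ {p f t} → p ≤ t → from p f t ≈ f t
  from-≥ {p} {f} {t} p≤t with t <? p
  ... | yes t<p = contradiction t<p (≤⇒≯ p≤t)
  ... | no  _   = refl

  from-cong : ∀ {p f g t} → f t ≈ g t → from p f t ≈ from p g t
  from-cong {p} {f} {g} {t} ft≈gt with t <? p
  ... | yes _ = refl
  ... | no  _ = ft≈gt

  inverseSquare : Carrier → Carrier
  inverseSquare t = t ⁻¹ * t ⁻¹

  -- `antiderivative p` is normalised to vanish at `p`, so cutting it off below `p` creates no jump.
  -- For `t` at or above `p`, `variation p t` is the total variation of the cut-off `inverseSquare`
  -- up to `t`: the jump 1/p² at `p`, then the decrease 1/p² - 1/t².
  antiderivative variation : Carrier → Carrier → Carrier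
  antiderivative p t = p ⁻¹ - t ⁻¹
  variation      p t = inverseSquare p + (inverseSquare p - inverseSquare t)

  module _ {p : Carrier} (0<p : 0# < p) where

    inverseSquare-antimono : ∀ {x y} → 0# < x → x ≤ y → inverseSquare y ≤ inverseSquare x
    inverseSquare-antimono 0<x x≤y = *-mono-≤ 0≤y⁻¹ 0≤y⁻¹ y⁻¹≤x⁻¹ y⁻¹≤x⁻¹
      where
      0<y   = begin-strict 0# <⟨ 0<x ⟩ _ ≤⟨ x≤y ⟩ _ ∎
      0≤y⁻¹ = inj₁ (⁻¹-pos 0<y)
      y⁻¹≤x⁻¹ = ⁻¹-antimono-≤ 0<x x≤y

    antiderivative-nonneg : ∀ t → 0# ≤ from p (antiderivative p) t
    antiderivative-nonneg t with t <? p
    ... | yes _   = ≤-refl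
    ... | no  t≮p = 0≤y-x (⁻¹-antimono-≤ 0<p (≮⇒≥ t≮p))

    -- The right side is the integral of 1/t² from `a` to `m`. Written as a product, it is the
    -- length times the value of 1/t² at the geometric mean of the endpoints, hence comparable with
    -- the extreme values.
    ⁻¹-difference : ∀ {a m} → 0# < a → 0# < m → a ⁻¹ * m ⁻¹ * (m - a) ≈ a ⁻¹ - m ⁻¹
    ⁻¹-difference {a} {m} 0<a 0<m = begin-equality
      a ⁻¹ * m ⁻¹ * (m - a)
        ≈⟨ solve 4 (λ a m u w → u :* w :* (m :- a) := u :* (m :* w) :- w :* (a :* u)) refl a m (a ⁻¹) (m ⁻¹) ⟩
      a ⁻¹ * (m * m ⁻¹) - m ⁻¹ * (a * a ⁻¹)
        ≈⟨ +-cong (*-congˡ (x*x⁻¹≈1 0<m)) (-‿cong (*-congˡ (x*x⁻¹≈1 0<a))) ⟩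
      a ⁻¹ * 1# - m ⁻¹ * 1#
        ≈⟨ +-cong (*-identityʳ _) (-‿cong (*-identityʳ _)) ⟩
      a ⁻¹ - m ⁻¹ ∎

    -- For a positive left end `a`, the sampled value times the length and the exact integral both
    -- lie between (m - a)/m² and (m - a)/a². The length of that interval is the increment of
    -- `variation p` times `m - a`.
    smooth-cell : ∀ {a t m} → 0# < a → a ≤ t → t ≤ m →
                  Within ((variation p m - variation p a) * (m - a)) (inverseSquare t * (m - a))
                         (antiderivative p m - antiderivative p a)
    smooth-cell {a} {t} {m} 0<a a≤t t≤m = within-cong
      (solve 4 (λ r u w d → u :* u :* d :- w :* w :* d := (r :* r :+ (r :* r :- w :* w) :- (r :* r :+ (r :* r :- u :* u))) :* d) refl
        (p ⁻¹) (a ⁻¹) (m ⁻¹) (m - a))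
      refl
      (trans (⁻¹-difference 0<a 0<m)
        (solve 3 (λ r u w → u :- w := (r :- w) :- (r :- u)) refl (p ⁻¹) (a ⁻¹) (m ⁻¹)))
      (within-interval
        (*-monoˡ-≤-nonneg 0≤m-a (inverseSquare-antimono 0<t t≤m))
        (*-monoˡ-≤-nonneg 0≤m-a (inverseSquare-antimono 0<a a≤t))
        (*-monoˡ-≤-nonneg 0≤m-a (*-mono-≤ 0≤m⁻¹ 0≤m⁻¹ m⁻¹≤a⁻¹ ≤-refl))
        (*-monoˡ-≤-nonneg 0≤m-a (*-mono-≤ 0≤a⁻¹ 0≤m⁻¹ ≤-refl m⁻¹≤a⁻¹)))
      where
      a≤m = ≤-trans a≤t t≤m
      0<t = begin-strict 0# <⟨ 0<a ⟩ a ≤⟨ a≤t ⟩ t ∎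
      0<m = begin-strict 0# <⟨ 0<a ⟩ a ≤⟨ a≤m ⟩ m ∎
      0≤m⁻¹ = inj₁ (⁻¹-pos 0<m)
      0≤a⁻¹ = inj₁ (⁻¹-pos 0<a)
      m⁻¹≤a⁻¹ = ⁻¹-antimono-≤ 0<a a≤m
      0≤m-a = 0≤y-x a≤m

    jump≤variation : ∀ {m} → p ≤ m → p ⁻¹ * p ⁻¹ ≤ variation p m
    jump≤variation p≤m = x≤x+y _ (0≤y-x (inverseSquare-antimono 0<p p≤m))

    -- When a cell straddles `p`, its tag may fall on either side, so of the sampled value `y` only
    -- 0 ≤ y ≤ 1/p² is used. The increment 1/p - 1/m is also between 0 and (m - a)/p², and the
    -- variation gained over the cell is at least the jump 1/p². Each `0#` that is subtracted is a
    -- cut-off value at the left end.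
    jump-cell : ∀ {a m y} → 0# < a → a ≤ p → p ≤ m → 0# ≤ y → y ≤ p ⁻¹ * p ⁻¹ →
                Within ((variation p m - 0#) * (m - a)) (y * (m - a)) (antiderivative p m - 0#)
    jump-cell {a} {m} {y} 0<a a≤p p≤m 0≤y y≤p⁻² = within-weaken
      (begin
        p ⁻¹ * p ⁻¹ * (m - a) - 0#   ≈⟨ solve 1 (λ x → x :- :0 := x) refl _ ⟩
        p ⁻¹ * p ⁻¹ * (m - a)        ≤⟨ *-monoˡ-≤-nonneg 0≤m-a (jump≤variation p≤m) ⟩
        variation p m * (m - a)        ≈⟨ solve 2 (λ v d → v :* d := (v :- :0) :* d) refl _ _ ⟩
        (variation p m - 0#) * (m - a) ∎)
      (within-interval
        (*-nonneg 0≤y 0≤m-a)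
        (*-monoˡ-≤-nonneg 0≤m-a y≤p⁻²)
        (≤-trans (0≤y-x (⁻¹-antimono-≤ 0<p p≤m)) (inj₂ (sym minus-zero)))
        (begin
          antiderivative p m - 0#           ≈⟨ minus-zero ⟩
          p ⁻¹ - m ⁻¹                 ≈⟨ ⁻¹-difference 0<p 0<m ⟨
          p ⁻¹ * m ⁻¹ * (m - p)       ≤⟨ *-mono-≤ (inj₁ (*-pos (⁻¹-pos 0<p) (⁻¹-pos 0<m))) (0≤y-x p≤m)
                                          (*-monoʳ-≤ (⁻¹-pos 0<p) (⁻¹-antimono-≤ 0<p p≤m))
                                          (≤-from-gap (0≤y-x a≤p)
                                            (solve 3 (λ a p m → (m :- p) :+ (p :- a) := m :- a) refl a p m)) ⟩
          p ⁻¹ * p ⁻¹ * (m - a)       ∎))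
      where
      0≤m-a = 0≤y-x (≤-trans a≤p p≤m)
      0<m = begin-strict 0# <⟨ 0<p ⟩ p ≤⟨ p≤m ⟩ m ∎
      minus-zero = solve 2 (λ r w → r :- w :- :0 := r :- w) refl (p ⁻¹) (m ⁻¹)

    step-controlled : ∀ {b} → Controlled b (from p inverseSquare) (from p (antiderivative p)) (from p (variation p))
    step-controlled .variation-mono {a} {m} 1≤a a≤m _ with a <? p | m <? p
    ... | yes _   | yes _   = ≤-refl
    ... | yes _   | no  m≮p = ≤-trans (square-nonneg (p ⁻¹)) (jump≤variation (≮⇒≥ m≮p))
    ... | no  a≮p | yes m<p = contradiction (begin-strict a ≤⟨ a≤m ⟩ m <⟨ m<p ⟩ p ∎) a≮p
    ... | no  a≮p | no  m≮p = ≤-from-gap (0≤y-x (inverseSquare-antimono (0<1≤ 1≤a) a≤m))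
      (solve 3 (λ r u w → r :+ (r :- u) :+ (u :- w) := r :+ (r :- w)) refl (p ⁻¹ * p ⁻¹) (inverseSquare a) (inverseSquare m))
    step-controlled .cell-error {a} {t} {m} 1≤a a≤t t≤m _ with a <? p | t <? p | m <? p
    ... | yes _   | yes _   | yes _   = within-cong
      (solve 1 (λ d → :0 := (:0 :- :0) :* d) refl (m - a)) (sym (zeroˡ _)) (sym (-‿inverseʳ 0#)) within-refl
    ... | _       | no  t≮p | yes m<p = contradiction (begin-strict t ≤⟨ t≤m ⟩ m <⟨ m<p ⟩ p ∎) t≮p
    ... | no  a≮p | yes t<p | _       = contradiction (begin-strict a ≤⟨ a≤t ⟩ t <⟨ t<p ⟩ p ∎) a≮p
    ... | yes a<p | yes _   | no  m≮p =
      jump-cell (0<1≤ 1≤a) (inj₁ a<p) (≮⇒≥ m≮p) ≤-refl (square-nonneg (p ⁻¹))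
    ... | yes a<p | no  t≮p | no  m≮p =
      jump-cell (0<1≤ 1≤a) (inj₁ a<p) (≮⇒≥ m≮p) (square-nonneg (t ⁻¹)) (inverseSquare-antimono 0<p (≮⇒≥ t≮p))
    ... | no  _   | no  _   | no  _   = smooth-cell (0<1≤ 1≤a) a≤t t≤m

  -- The integrand as a finite combination of steps.

  fromℕ-cancel-≤ : ∀ {m n t} → fromℕ m ≤ t → t < fromℕ (suc n) → m ℕ.≤ n
  fromℕ-cancel-≤ {m} {n} {t} m≤t t<1+n = ℕ.≮⇒≥ λ n<m →
    ≤⇒≯ (≤-trans (fromℕ-mono-≤ n<m) m≤t) t<1+n

  ⌊⌋-spec : ∀ {t} → 0# ≤ t → fromℕ ⌊ t ⌋ ≤ t × t < fromℕ (suc ⌊ t ⌋)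
  ⌊⌋-spec {t} 0≤t with t <? 0#
  ... | yes t<0 = contradiction t<0 (≤⇒≯ 0≤t)
  ... | no  t≮0 = proj₂ (floor t (≮⇒≥ t≮0))

  ≤⇒≤⌊⌋ : ∀ {k t} → 0# ≤ t → fromℕ k ≤ t → k ℕ.≤ ⌊ t ⌋
  ≤⇒≤⌊⌋ 0≤t k≤t = fromℕ-cancel-≤ k≤t (proj₂ (⌊⌋-spec 0≤t))

  -- For `t ≥ 0`, `k ≤ ⌊ t ⌋` and `fromℕ k ≤ t` are equivalent; this turns the arithmetic indicator
  -- into a cut-off at a real point.
  fromℕ-𝟙-* : ∀ {t} → 0# ≤ t → ∀ k d y →
              fromℕ (𝟙 (k ℕ.≤? ⌊ t ⌋) ℕ.* d) * y ≈ fromℕ d * from (fromℕ k) (λ _ → y) t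
  fromℕ-𝟙-* {t} 0≤t k d y with k ℕ.≤? ⌊ t ⌋
  ... | yes k≤⌊t⌋ = begin-equality
    fromℕ (𝟙 k≤? ℕ.* d) * y               ≡⟨ ≡.cong (λ e → fromℕ (e ℕ.* d) * y) (𝟙-true k≤? k≤⌊t⌋) ⟩
    fromℕ (1 ℕ.* d) * y                   ≡⟨ ≡.cong (λ e → fromℕ e * y) (ℕ.*-identityˡ d) ⟩
    fromℕ d * y                           ≈⟨ *-congˡ (from-≥ (≤-trans (fromℕ-mono-≤ k≤⌊t⌋) (proj₁ (⌊⌋-spec 0≤t)))) ⟨
    fromℕ d * from (fromℕ k) (λ _ → y) t  ∎
    where k≤? = k ℕ.≤? ⌊ t ⌋
  ... | no  k≰⌊t⌋ = begin-equality
    fromℕ (𝟙 k≤? ℕ.* d) * y               ≡⟨ ≡.cong (λ e → fromℕ (e ℕ.* d) * y) (𝟙-false k≤? k≰⌊t⌋) ⟩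
    0# * y                                ≈⟨ trans (zeroˡ y) (sym (zeroʳ _)) ⟩
    fromℕ d * 0#                          ≈⟨ *-congˡ (from-< t<k) ⟨
    fromℕ d * from (fromℕ k) (λ _ → y) t  ∎
    where
    k≤? = k ℕ.≤? ⌊ t ⌋
    t<k : t < fromℕ k
    t<k with <-≤-connex t (fromℕ k)
    ... | inj₁ t<k = t<k
    ... | inj₂ k≤t = contradiction (≤⇒≤⌊⌋ 0≤t k≤t) k≰⌊t⌋

  product : ℕ → ℕ → Carrier
  product j i = fromℕ (suc j ℕ.* suc i)

  0<product : ∀ j i → 0# < product j i
  0<product j i = 0<fromℕ (suc j ℕ.* suc i)

  -- `suc i` is the divisor being added up and `suc j` its cofactor. The ranges stay fixed as `t`
  -- varies, and the cut-offs select the pairs with product at most `t`. `f` also receives the jump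
  -- point because `antiderivative` and `variation` depend on it.
  pairSum : (Carrier → Carrier → Carrier) → ℕ → ℕ → Carrier → Carrier
  pairSum f m n t =
    partialSum (λ j → partialSum (λ i → fromℕ (suc i) * from (product j i) (f (product j i)) t) m) n

  ∑σ-pairSum : ∀ {t} → 0# ≤ t → ∀ {n} → ⌊ t ⌋ ℕ.≤ n → ∀ y →
               fromℕ (sum (map σ (1⋯ ⌊ t ⌋))) * y ≈ pairSum (λ _ _ → y) n n t
  ∑σ-pairSum {t} 0≤t {n} ⌊t⌋≤n y = begin-equality
    fromℕ (sum (map σ (1⋯ ⌊ t ⌋))) * y
      ≡⟨ ≡.cong (λ k → fromℕ k * y) (≡.trans (sum-map-1⋯ σ ⌊ t ⌋) (∑σ ⌊ t ⌋ ⌊t⌋≤n)) ⟩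
    fromℕ (∑ (λ j → ∑ (term j) n) n) * y
      ≈⟨ *-congʳ (trans (fromℕ-∑ (λ j → ∑ (term j) n) n) (partialSum-cong (λ j → fromℕ-∑ (term j) n) n)) ⟩
    partialSum (λ j → partialSum (fromℕ ∘ term j) n) n * y
      ≈⟨ trans (partialSum-*ʳ _ y n) (partialSum-cong (λ j → trans (partialSum-*ʳ (fromℕ ∘ term j) y n)
           (partialSum-cong (λ i → fromℕ-𝟙-* 0≤t (suc j ℕ.* suc i) (suc i) y) n)) n) ⟩
    pairSum (λ _ _ → y) n n t ∎
    where
    term : ℕ → ℕ → ℕ
    term j i = 𝟙 (suc j ℕ.* suc i ℕ.≤? ⌊ t ⌋) ℕ.* suc i

  ^2-inverse : ∀ {t} → 0# < t → (t ^ 2) ⁻¹ ≈ inverseSquare t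
  ^2-inverse {t} 0<t = trans (⁻¹-cong (*-congˡ (*-identityʳ t))) (⁻¹-distrib-* 0<t 0<t)

  ½ : Carrier
  ½ = fromℕ 2 ⁻¹

  𝒟/^2 : ∀ {t} → 1# ≤ t → ∀ {n} → ⌊ t ⌋ ℕ.≤ n →
         pairSum (λ _ → inverseSquare) n n t - ζ 2 * ½ ≈ 𝒟 t / t ^ 2
  𝒟/^2 {t} 1≤t {n} ⌊t⌋≤n = sym (begin-equality
    (S - t ^ 2 * ζ 2 * ½) * q
      ≈⟨ solve 5 (λ S s z ½ q → (S :- s :* z :* ½) :* q := S :* q :- z :* ½ :* (s :* q)) refl S (t ^ 2) (ζ 2) ½ q ⟩
    S * q - ζ 2 * ½ * (t ^ 2 * q)
      ≈⟨ +-cong (*-congˡ (^2-inverse 0<t)) (-‿cong (trans (*-congˡ (x*x⁻¹≈1 0<t²)) (*-identityʳ _))) ⟩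
    S * inverseSquare t - ζ 2 * ½
      ≈⟨ +-congʳ (∑σ-pairSum (inj₁ 0<t) ⌊t⌋≤n (inverseSquare t)) ⟩
    pairSum (λ _ _ → inverseSquare t) n n t - ζ 2 * ½
      -- The constant function `inverseSquare t` and `inverseSquare` agree at `t`, the only point at
      -- which the cut-off evaluates them.
      ≈⟨ +-congʳ (partialSum-cong (λ j → partialSum-cong (λ i → *-congˡ {fromℕ (suc i)}
           (from-cong {product j i} {λ _ → inverseSquare t} {inverseSquare} refl)) n) n) ⟩
    pairSum (λ _ → inverseSquare) n n t - ζ 2 * ½ ∎)
    where
    0<t = 0<1≤ 1≤t
    S = fromℕ (sum (map σ (1⋯ ⌊ t ⌋)))
    q = (t ^ 2) ⁻¹
    0<t² : 0# < t ^ 2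
    0<t² = begin-strict
      0#      <⟨ *-pos 0<t 0<t ⟩
      t * t   ≈⟨ *-congˡ (*-identityʳ t) ⟨
      t ^ 2   ∎

  -- For `t ≤ x` the range ⌊x⌋ covers every pair with product at most `t`. The term -ζ(2)/2 enters
  -- as a constant function, with variation 0, since scaling admits only nonnegative factors.
  𝒟-controlled : ∀ x → Controlled x (λ t → 𝒟 t / t ^ 2)
    (λ t → pairSum antiderivative ⌊ x ⌋ ⌊ x ⌋ t + - (ζ 2 * ½) * t)
    (λ t → pairSum variation ⌊ x ⌋ ⌊ x ⌋ t + 0#)
  𝒟-controlled x = controlled-cong
    (λ 1≤t t≤x → let 0≤t = inj₁ (0<1≤ 1≤t) in
      𝒟/^2 1≤t (≤⇒≤⌊⌋ (≤-trans 0≤t t≤x) (≤-trans (proj₁ (⌊⌋-spec 0≤t)) t≤x)))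
    (controlled-+
      (controlled-partialSum (λ j → controlled-partialSum (λ i →
        controlled-* (0≤fromℕ (suc i)) (step-controlled (0<product j i))) ⌊ x ⌋) ⌊ x ⌋)
      (controlled-const (- (ζ 2 * ½))))

  -- Numerical bounds for the harmonic sum and ζ(2).

  ½+½≈1 : ½ + ½ ≈ 1#
  -- `fromℕ 2` unfolds to `1# + (1# + 0#)`, which dictates the spelling of the factor.
  ½+½≈1 = trans (solve 1 (λ ½ → ½ :+ ½ := (:1 :+ (:1 :+ :0)) :* ½) refl ½) (x*x⁻¹≈1 (0<fromℕ 2))

  reciprocal : ℕ → Carrier
  reciprocal n = fromℕ (suc n) ⁻¹

  1⁻¹≈1 : reciprocal 0 ≈ 1#
  1⁻¹≈1 = ⁻¹-unique (0<fromℕ 1) (solve 0 ((:1 :+ :0) :* :1 := :1) refl)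

  zetaTerm-2 : ∀ n → zetaTerm 2 n ≈ reciprocal n * reciprocal n
  zetaTerm-2 n = begin-equality
    1# * fromℕ (suc n ℕ.* (suc n ℕ.* 1)) ⁻¹   ≈⟨ *-identityˡ _ ⟩
    fromℕ (suc n ℕ.* (suc n ℕ.* 1)) ⁻¹        ≡⟨ ≡.cong (λ k → fromℕ (suc n ℕ.* k) ⁻¹) (ℕ.*-identityʳ (suc n)) ⟩
    fromℕ (suc n ℕ.* suc n) ⁻¹                ≈⟨ ⁻¹-cong (·1-homo-* (suc n) (suc n)) ⟩
    (fromℕ (suc n) * fromℕ (suc n)) ⁻¹        ≈⟨ ⁻¹-distrib-* (0<fromℕ (suc n)) (0<fromℕ (suc n)) ⟩
    reciprocal n * reciprocal n               ∎

  -- Oresme's grouping: lowering 1/3 to 1/4, and 1/5, 1/6, 1/7 to 1/8, leaves 1 + 1/2 + 2/4 + 4/8.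
  -- This exceeds 9/4 by 1/4.
  5/2≤harmonic : ∀ {n} → 8 ℕ.≤ n → 1# + 1# + ½ ≤ partialSum reciprocal n
  5/2≤harmonic {n} 8≤n = begin
    1# + 1# + ½
      ≈⟨ solve 2 (λ ½ o → :1 :+ :1 :+ ½ := :1 :+ ½ :+ :1 :* :1) refl ½ 1# ⟩
    1# + ½ + 1# * 1#
      -- The solver sees `½` as a free variable, so each use of `½ + ½ ≈ 1#` is inserted by hand.
      ≈⟨ +-congˡ (*-cong ½+½≈1 ½+½≈1) ⟨
    1# + ½ + (½ + ½) * (½ + ½)
      ≈⟨ solve 1 (λ ½ → :1 :+ ½ :+ (½ :+ ½) :* (½ :+ ½)
           := :1 :+ ½ :+ (½ :* ½ :+ ½ :* ½) :+ :1 :* (½ :* ½ :+ ½ :* ½)) refl ½ ⟩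
    1# + ½ + (½ * ½ + ½ * ½) + 1# * (½ * ½ + ½ * ½)
      ≈⟨ +-congˡ (*-congʳ ½+½≈1) ⟨
    1# + ½ + (½ * ½ + ½ * ½) + (½ + ½) * (½ * ½ + ½ * ½)
      ≈⟨ solve 1 (λ ½ → :1 :+ ½ :+ (½ :* ½ :+ ½ :* ½) :+ (½ :+ ½) :* (½ :* ½ :+ ½ :* ½)
           := :0 :+ :1 :+ ½ :+ ½ :* ½ :+ ½ :* ½ :+ ½ :* (½ :* ½) :+ ½ :* (½ :* ½)
              :+ ½ :* (½ :* ½) :+ ½ :* (½ :* ½)) refl ½ ⟩
    0# + 1# + ½ + ½ * ½ + ½ * ½ + ½ * (½ * ½) + ½ * (½ * ½) + ½ * (½ * ½) + ½ * (½ * ½)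
      ≤⟨ +-mono-≤ (+-mono-≤ (+-mono-≤ (+-mono-≤ (+-mono-≤ (+-mono-≤ (+-mono-≤ (+-monoʳ-≤ 0#
           (inj₂ (sym 1⁻¹≈1))) ≤-refl) (quarter 2)) (quarter 3)) (eighth 4)) (eighth 5)) (eighth 6)) (eighth 7) ⟩
    partialSum reciprocal 8
      ≤⟨ partialSum-mono (λ i → inj₁ (⁻¹-pos (0<fromℕ (suc i)))) (ℕ.≤⇒≤′ 8≤n) ⟩
    partialSum reciprocal n ∎
    where
    quarter : ∀ i {i<4 : True (i ℕ.<? 4)} → ½ * ½ ≤ reciprocal i
    quarter i {i<4} = begin
      ½ * ½          ≈⟨ trans (⁻¹-cong (·1-homo-* 2 2)) (⁻¹-distrib-* (0<fromℕ 2) (0<fromℕ 2)) ⟨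
      reciprocal 3   ≤⟨ ⁻¹-antimono-≤ (0<fromℕ (suc i)) (fromℕ-mono-≤ (toWitness i<4)) ⟩
      reciprocal i   ∎

    eighth : ∀ i {i<8 : True (i ℕ.<? 8)} → ½ * (½ * ½) ≤ reciprocal i
    eighth i {i<8} = begin
      ½ * (½ * ½)    ≈⟨ *-congˡ (trans (⁻¹-cong (·1-homo-* 2 2)) (⁻¹-distrib-* (0<fromℕ 2) (0<fromℕ 2))) ⟨
      ½ * reciprocal 3 ≈⟨ trans (⁻¹-cong (·1-homo-* 2 4)) (⁻¹-distrib-* (0<fromℕ 2) (0<fromℕ 4)) ⟨
      reciprocal 7   ≤⟨ ⁻¹-antimono-≤ (0<fromℕ (suc i)) (fromℕ-mono-≤ (toWitness i<8)) ⟩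
      reciprocal i   ∎

  -- If a partial sum overshot the limit, all later ones would overshoot at least as much;
  -- convergence with that overshoot as ε rules this out.
  sumsTo⇒partialSum≤ : ∀ {a z} → (∀ i → 0# ≤ a i) → a SumsTo z → ∀ n → partialSum a n ≤ z
  sumsTo⇒partialSum≤ {a} {z} 0≤a a↑z n with <-≤-connex z (partialSum a n)
  ... | inj₂ S≤z = S≤z
  ... | inj₁ z<S with a↑z (partialSum a n - z) (0<y-x z<S)
  ...   | N , close = contradiction (proj₁ (close (N ℕ.⊔ n) (ℕ.m≤m⊔n N n)))
    (≤⇒≯ (+-monoˡ-≤ (- z) (partialSum-mono 0≤a (ℕ.≤⇒≤′ (ℕ.m≤n⊔m N n)))))

  sumsTo⇒≤bound : ∀ {a z b} → a SumsTo z → (∀ n → partialSum a n ≤ b) → z ≤ b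
  sumsTo⇒≤bound {a} {z} {b} a↑z S≤b with <-≤-connex b z
  ... | inj₂ z≤b = z≤b
  ... | inj₁ b<z with a↑z (z - b) (0<y-x b<z)
  ...   | N , close = contradiction (proj₂ (close N ℕ.≤-refl))
    (≤⇒≯ (+-monoʳ-≤ z (-‿antimono-≤ (S≤b N))))

  zetaSum≤ζ : ∀ n → partialSum (zetaTerm 2) n ≤ ζ 2
  zetaSum≤ζ = sumsTo⇒partialSum≤ (zetaTerm-pos 2) (proj₂ (zeta-converges 2))

  -- Comparison of 1/n² with the telescoping 1/(n - 1) - 1/n for n ≥ 2, which is `zeta-partialSum`
  -- at exponent 2.
  ζ≤2 : ζ 2 ≤ 1# + 1#
  ζ≤2 = sumsTo⇒≤bound (proj₂ (zeta-converges 2)) λ n → begin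
    partialSum (zetaTerm 2) n                              ≤⟨ x≤x+y _ (zetaTerm-pos 2 n) ⟩
    partialSum (zetaTerm 2) (suc n)                        ≤⟨ x≤x+y _ (inj₁ (⁻¹-pos (0<fromℕ (suc n)))) ⟩
    partialSum (zetaTerm 2) (suc n) + fromℕ (suc n) ⁻¹     ≤⟨ zeta-partialSum 0 n ⟩
    0# + 1# * fromℕ 1 ⁻¹ + fromℕ 1 ⁻¹                      ≈⟨ +-cong (+-congˡ (*-congˡ 1⁻¹≈1)) 1⁻¹≈1 ⟩
    0# + 1# * 1# + 1#                                      ≈⟨ solve 0 (:0 :+ :1 :* :1 :+ :1 := :1 :+ :1) refl ⟩
    1# + 1#                                                ∎

  -- The value at the lower endpoint is subtracted in the integral, so its sign allows it to be
  -- dropped.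
  pairSum-antiderivative-nonneg : ∀ m n t → 0# ≤ pairSum antiderivative m n t
  pairSum-antiderivative-nonneg m n t = partialSum-nonneg (λ j → partialSum-nonneg (λ i →
    *-nonneg (0≤fromℕ (suc i)) (antiderivative-nonneg (0<product j i) t)) m) n

  -- Bounding each row, and the sign of the integral.

  module _ {x : Carrier} (1≤x : 1# ≤ x) where
    private
      0<x = 0<1≤ 1≤x
      y : Carrier
      y = x ⁻¹

    module _ (j : ℕ) where
      private
        s : Carrier
        s = fromℕ (suc j) ⁻¹

        rowSum : ℕ → Carrier
        rowSum = partialSum (λ i → fromℕ (suc i) * from (product j i) (antiderivative (product j i)) x)

        product-inverse : ∀ i → fromℕ (suc i) * product j i ⁻¹ ≈ s
        product-inverse i = begin-equality
          k * product j i ⁻¹    ≈⟨ *-congˡ (trans (⁻¹-cong (·1-homo-* (suc j) (suc i)))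
                                             (⁻¹-distrib-* (0<fromℕ (suc j)) (0<fromℕ (suc i)))) ⟩
          k * (s * k ⁻¹)        ≈⟨ solve 3 (λ k s u → k :* (s :* u) := s :* (k :* u)) refl k s (k ⁻¹) ⟩
          s * (k * k ⁻¹)        ≈⟨ trans (*-congˡ (x*x⁻¹≈1 (0<fromℕ (suc i)))) (*-identityʳ s) ⟩
          s                     ∎
          where k = fromℕ (suc i)

        -- The closed form of Σ_{d ≤ k} (1/e - d/x) with `e = suc j`, extended to real `k`.
        parabola : Carrier → Carrier
        parabola k = k * s - ½ * (k * (1# + k)) * y

      -- The hypothesis puts every jump point of the first `k` terms at or below `x`, so no cut-off
      -- vanishes for being out of range. The term with d = k + 1 then adds 1/e - (k + 1)/x.
      rowSum-parabola : ∀ k → fromℕ (suc j ℕ.* k) ≤ x → rowSum k ≈ parabola (fromℕ k)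
      rowSum-parabola zero    _     = solve 3 (λ s ½ y → :0 := :0 :* s :- ½ :* (:0 :* (:1 :+ :0)) :* y) refl s ½ y
      rowSum-parabola (suc k) ek≤x  = begin-equality
        rowSum k + (1# + κ) * from (product j k) (antiderivative (product j k)) x
          ≈⟨ +-cong (rowSum-parabola k (≤-trans (fromℕ-mono-≤ (ℕ.*-monoʳ-≤ (suc j) (ℕ.n≤1+n k))) ek≤x))
                     (*-congˡ (from-≥ ek≤x)) ⟩
        parabola κ + (1# + κ) * (product j k ⁻¹ - y)
          -- The factor `:1` is planted so that the next step can replace it by `½ + ½`.
          ≈⟨ solve 6 (λ κ s ½ y w o → κ :* s :- ½ :* (κ :* (:1 :+ κ)) :* y :+ (:1 :+ κ) :* (w :- y)
                                   := κ :* s :- ½ :* (κ :* (:1 :+ κ)) :* y :+ ((:1 :+ κ) :* w :- (:1 :+ κ) :* :1 :* y))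
               refl κ s ½ y (product j k ⁻¹) 1# ⟩
        parabola κ + ((1# + κ) * product j k ⁻¹ - (1# + κ) * 1# * y)
          ≈⟨ +-congˡ (+-cong (product-inverse k) (-‿cong (*-congʳ (*-congˡ (sym ½+½≈1))))) ⟩
        parabola κ + (s - (1# + κ) * (½ + ½) * y)
          ≈⟨ solve 4 (λ κ s ½ y → κ :* s :- ½ :* (κ :* (:1 :+ κ)) :* y :+ (s :- (:1 :+ κ) :* (½ :+ ½) :* y)
                               := (:1 :+ κ) :* s :- ½ :* ((:1 :+ κ) :* (:1 :+ (:1 :+ κ))) :* y)
               refl κ s ½ y ⟩
        parabola (1# + κ) ∎
        where κ = fromℕ k

      -- The maximum of `parabola` over real `k`, attained at `k = x * s - ½`.
      rowBound : Carrier
      rowBound = ½ * (x * (s * s) - s + ½ * ½ * y)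

      -- The gap is ½ y (x s - k - ½)², an identity modulo x y = 1 and ½ + ½ = 1;
      -- the cofactors of x y - 1 and ½ + ½ - 1 are explicit.
      parabola≤rowBound : ∀ k → parabola k ≤ rowBound
      parabola≤rowBound k = ≤-from-gap
        (*-nonneg (inj₁ (*-pos (⁻¹-pos (0<fromℕ 2)) (⁻¹-pos 0<x))) (square-nonneg (x * s - k - ½)))
        (begin-equality
          parabola k + ½ * y * ((x * s - k - ½) * (x * s - k - ½))
            ≈⟨ solve 5 (λ k s ½ x y →
                 k :* s :- ½ :* (k :* (:1 :+ k)) :* y :+ ½ :* y :* ((x :* s :- k :- ½) :* (x :* s :- k :- ½))
                 := ½ :* (x :* (s :* s) :- s :+ ½ :* ½ :* y)
                    :+ ((x :* y :- :1) :* (½ :* x :* s :* s :- (½ :+ ½) :* s :* k :- (½ :+ ½) :* ½ :* s)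
                    :+ (½ :+ ½ :- :1) :* (½ :* k :* y :- s :* k :- ½ :* s)))
                 refl k s ½ x y ⟩
          rowBound + ((x * y - 1#) * _ + (½ + ½ - 1#) * _)
            ≈⟨ +-congˡ (+-cong (*-congʳ (+-congʳ (x*x⁻¹≈1 0<x))) (*-congʳ (+-congʳ ½+½≈1))) ⟩
          rowBound + ((1# - 1#) * _ + (1# - 1#) * _)
            ≈⟨ solve 3 (λ b p q → b :+ ((:1 :- :1) :* p :+ (:1 :- :1) :* q) := b) refl rowBound _ _ ⟩
          rowBound ∎)

      -- Bounding every rowSum k avoids ⌊x / e⌋: either the last term is active and
      -- the closed form applies, or it vanishes.
      rowSum≤rowBound : ∀ k → rowSum k ≤ rowBound
      rowSum≤rowBound zero    = ≤-trans
        (inj₂ (rowSum-parabola 0 (≤-trans (inj₂ (reflexive (≡.cong fromℕ (ℕ.*-zeroʳ j)))) (inj₁ 0<x))))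
        (parabola≤rowBound 0#)
      rowSum≤rowBound (suc k) with <-≤-connex x (product j k)
      ... | inj₁ x<p = begin
        rowSum k + fromℕ (suc k) * from (product j k) (antiderivative (product j k)) x
                       ≈⟨ +-congˡ (trans (*-congˡ (from-< x<p)) (zeroʳ _)) ⟩
        rowSum k + 0#  ≈⟨ +-identityʳ _ ⟩
        rowSum k       ≤⟨ rowSum≤rowBound k ⟩
        rowBound       ∎
      ... | inj₂ p≤x = ≤-trans (inj₂ (rowSum-parabola (suc k) p≤x)) (parabola≤rowBound (fromℕ (suc k)))

    -- The three terms of `rowBound` sum to a truncated ζ(2), a harmonic sum and a multiple of n/x;
    -- the last is at most 1/4 inside the bracket once n is ⌊x⌋.
    ∑rowBound : ∀ n → partialSum rowBound n ≈
                ½ * (x * partialSum (zetaTerm 2) n - partialSum reciprocal n + ½ * ½ * (fromℕ n * y))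
    ∑rowBound zero    = solve 3 (λ x y ½ → :0 := ½ :* (x :* :0 :- :0 :+ ½ :* ½ :* (:0 :* y))) refl x y ½
    ∑rowBound (suc n) = trans (+-cong (∑rowBound n) (*-congˡ (+-congʳ (+-congʳ (*-congˡ (sym (zetaTerm-2 n)))))))
      (solve 8 (λ x y ½ Z H k z s →
          ½ :* (x :* Z :- H :+ ½ :* ½ :* (k :* y)) :+ ½ :* (x :* z :- s :+ ½ :* ½ :* y)
          := ½ :* (x :* (Z :+ z) :- (H :+ s) :+ ½ :* ½ :* ((:1 :+ k) :* y)))
        refl x y ½ (partialSum (zetaTerm 2) n) (partialSum reciprocal n) (fromℕ n) (zetaTerm 2 n) (reciprocal n))

    integral<0 : 8 ℕ.≤ ⌊ x ⌋ →
      (pairSum antiderivative ⌊ x ⌋ ⌊ x ⌋ x + - (ζ 2 * ½) * x)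
      - (pairSum antiderivative ⌊ x ⌋ ⌊ x ⌋ 1# + - (ζ 2 * ½) * 1#) < 0#
    integral<0 8≤N = begin-strict
      (A + - (ζ 2 * ½) * x) - (B₁ + - (ζ 2 * ½) * 1#)
        ≤⟨ ≤-from-gap (pairSum-antiderivative-nonneg N N 1#)
             (solve 5 (λ A B z ½ x → (A :+ :- (z :* ½) :* x) :- (B :+ :- (z :* ½) :* :1) :+ B := A :+ (z :* ½ :- z :* ½ :* x))
               refl A B₁ (ζ 2) ½ x) ⟩
      A + (ζ 2 * ½ - ζ 2 * ½ * x)
        ≤⟨ +-monoˡ-≤ _ (≤-trans (partialSum-mono-≤ (λ j → rowSum≤rowBound j N) N) (inj₂ (∑rowBound N))) ⟩
      ½ * (x * Z - H + ½ * ½ * (fromℕ N * y)) + (ζ 2 * ½ - ζ 2 * ½ * x)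
        ≤⟨ +-monoˡ-≤ _ (*-monoʳ-≤ 0<½ (+-mono-≤ (+-monoˡ-≤ _ (*-monoʳ-≤ 0<x (zetaSum≤ζ N)))
                                                 (*-monoʳ-≤ (*-pos 0<½ 0<½) Ny≤1))) ⟩
      ½ * (x * ζ 2 - H + ½ * ½ * 1#) + (ζ 2 * ½ - ζ 2 * ½ * x)
        -- The two terms x ζ(2)/2 cancel here, leaving a bound that depends on `x` only through the
        -- harmonic sum.
        ≈⟨ solve 4 (λ ½ x z H → ½ :* (x :* z :- H :+ ½ :* ½ :* :1) :+ (z :* ½ :- z :* ½ :* x) := ½ :* (z :+ (½ :* ½ :- H)))
             refl ½ x (ζ 2) H ⟩
      ½ * (ζ 2 + (½ * ½ - H))
        ≤⟨ *-monoʳ-≤ 0<½ (+-mono-≤ ζ≤2 (+-monoʳ-≤ (½ * ½) (-‿antimono-≤ (5/2≤harmonic 8≤N)))) ⟩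
      ½ * (1# + 1# + (½ * ½ - (1# + 1# + ½)))
        -- The bracket is 2 + 1/4 - 5/2 = -1/4, so the final bound is -1/8.
        ≈⟨ solve 1 (λ ½ → ½ :* (:1 :+ :1 :+ (½ :* ½ :- (:1 :+ :1 :+ ½))) := ½ :* (½ :* ½ :- :1 :* ½)) refl ½ ⟩
      ½ * (½ * ½ - 1# * ½)
        ≈⟨ *-congˡ (+-congˡ (-‿cong (*-congʳ ½+½≈1))) ⟨
      ½ * (½ * ½ - (½ + ½) * ½)
        ≈⟨ solve 1 (λ ½ → ½ :* (½ :* ½ :- (½ :+ ½) :* ½) := :0 :- ½ :* (½ :* ½)) refl ½ ⟩
      0# - ½ * (½ * ½)
        <⟨ x-y<x 0# (*-pos 0<½ (*-pos 0<½ 0<½)) ⟩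
      0# ∎
      where
      N = ⌊ x ⌋
      A = pairSum antiderivative N N x
      B₁ = pairSum antiderivative N N 1#
      Z = partialSum (zetaTerm 2) N
      H = partialSum reciprocal N

      0<½ : 0# < ½
      0<½ = ⁻¹-pos (0<fromℕ 2)

      Ny≤1 : fromℕ N * y ≤ 1#
      Ny≤1 = ≤-trans (*-monoˡ-≤-nonneg (inj₁ (⁻¹-pos 0<x)) (proj₁ (⌊⌋-spec (inj₁ 0<x)))) (inj₂ (x*x⁻¹≈1 0<x))

corollary1p1 : {ℓ : Level} (ℝ : CompleteOrderedField ℓ) →
    let open RealAnalysis ℝ in
    (x : Carrier) → fromℕ 650 ≤ x →
    ∃ λ I → IsIntegral 1# x (λ t → 𝒟 t / t ^ 2) I × I < 0#
-- The witness `_` is determined by `controlled⇒integral`: the increment from 1 to `x` of the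
-- antiderivative in `𝒟-controlled`.
corollary1p1 ℝ x 650≤x = _ ,
  controlled⇒integral 1≤x (𝒟-controlled x) ,
  integral<0 1≤x (≤⇒≤⌊⌋ (inj₁ (0<1≤ 1≤x)) 8≤x)
  where
  open RealAnalysis ℝ
  open Analysis ℝ
  8≤x : fromℕ 8 ≤ x
  -- 8 is the number of harmonic terms in the grouping, and 642 = 650 - 8.
  8≤x = ≤-trans (fromℕ-mono-≤ (ℕ.m≤m+n 8 642)) 650≤x
  1≤x : 1# ≤ x
  1≤x = ≤-trans (x≤x+y 1# (0≤fromℕ 7)) 8≤x
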